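{- Let $p$ be a prime, let $n>0$ and $r$ be integers, let $\alpha$ be a positive integer and $l\in\mathbb{N}$. Then $$ {\rm ord}_p\bigg(\sum_{k\equiv r\pmod{p^{\alpha}}}\left\langle {n \atop k}\right\rangle \binom{(k-r)/p^{\alpha}}{l}\bigg)\geq{\rm ord}_p\bigg(\left\lfloor\frac{n}{p^{\alpha-1}}\right\rfloor!\bigg)-\left\lceil \frac{p^{\alpha-1}+lp^{\alpha}}{p^{\alpha-1}(p-1)}\right\rceil . $$ Moreover, if $a$ is an integer with $a\equiv 1\pmod{p}$ and $n\geq p^\alpha$, then $$ \sum_{k\equiv r\pmod{p^{\alpha}}}\left\langle {n \atop k}\right\rangle a^{k}\equiv 0\pmod{p^{{\rm ord}_p(\lfloor n/p^{\alpha-1}\rfloor!)-1}}. $$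
   Context: For $n\ge 1$ and an integer $k$, the Eulerian number $\left\langle {n \atop k}\right\rangle$ is the number of permutations $a_1a_2\cdots a_n$ of $\{1,\dots,n\}$ having exactly $k$ ascents (indices $i\in\{1,\dots,n-1\}$ with $a_i<a_{i+1}$); in particular it is $0$ for $k<0$ and for $k>n-1$, so the sums are over all integers $k$ in the given residue class and are finite. For an integer $x$ and $l\in\mathbb{N}$, $\binom{x}{0}=1$ and $\binom{x}{l}=x(x-1)\cdots(x-l+1)/l!$. For a prime $p$ and nonzero integer $a$, ${\rm ord}_p(a)=\sup\{i\in\mathbb{N}: p^i\mid a\}$, and ${\rm ord}_p(0)=\infty$. $\lfloor\cdot\rfloor$ and $\lceil\cdot\rceil$ are the floor and ceiling functions. -}

module Defs where

open import Data.Nat as ℕ using (ℕ; zero; suc; _∸_; _^_; _!)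
open import Data.Nat.Properties using (_!≢0)
open import Data.Nat.Divisibility as ℕD using ()
open import Data.Integer as ℤ using (ℤ; +_; _/ℕ_)
open import Data.Integer.Divisibility as ℤD using ()
open import Data.List using (List; []; _∷_; map; concatMap; length; filter)
open import Data.Bool using (Bool; true; false; if_then_else_)
open import Relation.Nullary using (¬_; Dec; yes; no; does)
open import Data.Product using (_×_)

insertions : ℕ → List ℕ → List (List ℕ)
insertions x []       = (x ∷ []) ∷ []
insertions x (y ∷ ys) = (x ∷ y ∷ ys) ∷ map (y ∷_) (insertions x ys)

perms : List ℕ → List (List ℕ)
perms []       = [] ∷ []
perms (x ∷ xs) = concatMap (insertions x) (perms xs)

-- the list 1 ∷ 2 ∷ … ∷ n  (built as n ∷ … ∷ 1, order irrelevant for perms)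
oneTo : ℕ → List ℕ
oneTo zero    = []
oneTo (suc n) = suc n ∷ oneTo n

ascents : List ℕ → ℕ
ascents []           = 0
ascents (x ∷ [])     = 0
ascents (x ∷ y ∷ ys) = (if does (x ℕ.<? y) then 1 else 0) ℕ.+ ascents (y ∷ ys)

eulerian : ℕ → ℕ → ℕ
eulerian n k = length (filter (λ π → ascents π ℕ.≟ k) (perms (oneTo n)))

fallingℤ : ℤ → ℕ → ℤ
fallingℤ x zero    = + 1
fallingℤ x (suc l) = fallingℤ x l ℤ.* (x ℤ.- + l)

binomℤ : ℤ → ℕ → ℤ
binomℤ x l = _/ℕ_ (fallingℤ x l) (l !) {{l !≢0}}

sumBelow : ℕ → (ℕ → ℤ) → ℤ
sumBelow zero    f = + 0
sumBelow (suc n) f = sumBelow n f ℤ.+ f n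

-- exact quotient by a positive modulus (junk value 0 for modulus 0)
quotℤ : ℤ → ℕ → ℤ
quotℤ x zero    = + 0
quotℤ x (suc m) = x /ℕ suc m

-- Σ_{k ≡ r (mod M)} ⟨n k⟩ · g((k - r)/M)
-- (Eulerian numbers vanish outside 0 ≤ k ≤ n-1, so the sum runs over k < n)
residueSum : ℕ → ℤ → ℕ → (ℤ → ℕ → ℤ) → ℤ
residueSum n r M g =
  sumBelow n (λ k → if does (M ℕD.∣? ℤ.∣ + k ℤ.- r ∣)
                    then + eulerian n k ℤ.* g (quotℤ (+ k ℤ.- r) M) k
                    else + 0)

-- ceiling division ⌈a / b⌉ for b > 0 (junk 0 for b = 0)

ceilDiv : ℕ → ℕ → ℕ
ceilDiv a zero    = 0
ceilDiv a (suc b) = (a ℕ.+ b) ℕ./ suc b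

IsOrd : ℕ → ℕ → ℕ → Set
IsOrd p a e = (p ^ e) ℕD.∣ a × ¬ ((p ^ suc e) ℕD.∣ a)

-- ord_p(x) ≥ t  (t ∈ ℤ, with ord_p(0) = ∞): every natural i ≤ t has p^i ∣ x
OrdGe : ℕ → ℤ → ℤ → Set
OrdGe p x t = ∀ (i : ℕ) → + i ℤ.≤ t → (+ (p ^ i)) ℤD.∣ x

-- floor division ⌊a / b⌋ for b > 0 (junk 0 for b = 0)
floorDiv : ℕ → ℕ → ℕ
floorDiv a zero    = 0
floorDiv a (suc b) = a ℕ./ suc b

{-# OPTIONS --safe #-}

-- Pair the n-th row of Eulerian numbers with a function f : ℕ → ℤ. Expanding the Eulerian
-- polynomial around x = 1, A_n(x) = Σ_j j! S(n,j) (x - 1)^{n-j}, the pairing becomes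
-- Σ_j j! S(n,j) (Δ^{n-j} f)(0). Put φ = p^{α-1}(p-1). The first of the
-- following bounds loses a factor p for every φ differences, which the second one regains:
--   * ord_p(j! S(n,j)) ≥ ord_p(⌊n/p^{α-1}⌋!) - ⌊(n-j)/φ⌋, by induction on j along
--     j! S(n,j) = Σ_{i<n} C(n,i) (j-1)! S(i,j-1) and Legendre's bound on ord_p(m!);
--   * ord_p(Δ^k f) ≥ ⌊(k - B)/φ⌋ for f = [k ≡ r] C((k-r)/p^α, l), with B = p^{α-1} + l p^α, and for
--     f = [k ≡ r] a^k, with B = p^{α-1}. Indeed f satisfies a difference equation with step p^α,
--     and by Newton's formula that shift is 1 + Δ^{p^α} up to terms C(p^α,k) Δ^k, 0 < k < p^α,
--     in which p to the power α - ord_p(k) makes up for the missing differences.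

module Submission where

open import Defs
open import Data.Nat as ℕ using (ℕ; _∸_; _^_; _!; _*_; _+_)
open import Data.Nat.Primality using (Prime)
open import Data.Integer as ℤ using (ℤ; +_)
open import Data.Integer.Divisibility as ℤD using ()
open import Data.Product using (_×_)
open import Data.Nat using (zero; suc; pred; _/_; _%_; _<_; _≤_; NonZero; z≤n; s≤s; >-nonZero; nonTrivial⇒n>1)
open import Data.Nat.Combinatorics
  using (_C_; nCn≡1; nC1≡n; k>n⇒nCk≡0; nCk+nC[k+1]≡[n+1]C[k+1]; nCk≡n!/k![n-k]!; k![n∸k]!∣n!)
open import Data.Nat.Divisibility
open import Data.Nat.DivMod
open import Data.Nat.Induction using (<-rec)
open import Data.Nat.Primality using (prime⇒nonZero; prime⇒nonTrivial; euclidsLemma)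
open import Data.Nat.Properties
open import Data.Nat.Tactic.RingSolver using (solve-∀)
open import Data.Integer using (0ℤ; 1ℤ; -1ℤ)
import Data.Integer.DivMod as ℤ
import Data.Integer.Divisibility.Signed as ℤS
import Data.Integer.Properties as ℤ
open import Data.Integer.Tactic.RingSolver using () renaming (solve-∀ to solve-∀ᶻ)
open import Data.Bool using (true; false; if_then_else_)
open import Data.List using (List; []; _∷_; _++_; map; concatMap; length; filter)
open import Data.List.Relation.Unary.All as All using (All; []; _∷_)
import Data.List.Relation.Unary.All.Properties as All
open import Data.Product using (_,_; ∃₂; ∃-syntax)
open import Data.Sum using (inj₁; inj₂)
open import Function using (_∘_; mk⇔)
open import Relation.Nullary using (¬_; yes; no; does; contradiction)
open import Relation.Nullary.Decidable using (dec-true; dec-false; does-⇔)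
open import Relation.Binary.PropositionalEquality

-- Finite differences

sumBelow-cong : ∀ n {f g : ℕ → ℤ} → (∀ {k} → k < n → f k ≡ g k) → sumBelow n f ≡ sumBelow n g
sumBelow-cong zero    f≡g = refl
sumBelow-cong (suc n) f≡g = cong₂ ℤ._+_ (sumBelow-cong n (f≡g ∘ m<n⇒m<1+n)) (f≡g (n<1+n n))

sumBelow-+ : ∀ n (f g : ℕ → ℤ) → sumBelow n (λ k → f k ℤ.+ g k) ≡ sumBelow n f ℤ.+ sumBelow n g
sumBelow-+ zero    f g = refl
sumBelow-+ (suc n) f g = trans (cong (ℤ._+ (f n ℤ.+ g n)) (sumBelow-+ n f g))
  (interchange (sumBelow n f) (sumBelow n g) (f n) (g n))
  where
  interchange : ∀ a b c d → a ℤ.+ b ℤ.+ (c ℤ.+ d) ≡ a ℤ.+ c ℤ.+ (b ℤ.+ d)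
  interchange = solve-∀ᶻ

sumBelow-suc : ∀ n (f : ℕ → ℤ) → sumBelow (suc n) f ≡ f 0 ℤ.+ sumBelow n (f ∘ suc)
sumBelow-suc zero    f = ℤ.+-comm 0ℤ (f 0)
sumBelow-suc (suc n) f = trans (cong (ℤ._+ f (suc n)) (sumBelow-suc n f)) (ℤ.+-assoc (f 0) _ _)

Δ : ℕ → (ℕ → ℤ) → ℕ → ℤ
Δ zero    f x = f x
Δ (suc k) f x = Δ k f (suc x) ℤ.- Δ k f x

Δ-cong : ∀ k {f g : ℕ → ℤ} → (∀ x → f x ≡ g x) → ∀ x → Δ k f x ≡ Δ k g x
Δ-cong zero    f≡g x = f≡g x
Δ-cong (suc k) f≡g x = cong₂ ℤ._-_ (Δ-cong k f≡g (suc x)) (Δ-cong k f≡g x)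

Δ-shift : ∀ k f m x → Δ k (λ y → f (y + m)) x ≡ Δ k f (x + m)
Δ-shift zero    f m x = refl
Δ-shift (suc k) f m x = cong₂ ℤ._-_ (Δ-shift k f m (suc x)) (Δ-shift k f m x)

Δ-0 : ∀ k x → Δ k (λ _ → 0ℤ) x ≡ 0ℤ
Δ-0 zero    x = refl
Δ-0 (suc k) x = cong₂ ℤ._-_ (Δ-0 k (suc x)) (Δ-0 k x)

Δ-+ : ∀ k f g x → Δ k (λ y → f y ℤ.+ g y) x ≡ Δ k f x ℤ.+ Δ k g x
Δ-+ zero    f g x = refl
Δ-+ (suc k) f g x = trans (cong₂ ℤ._-_ (Δ-+ k f g (suc x)) (Δ-+ k f g x))
  (interchange (Δ k f (suc x)) (Δ k g (suc x)) (Δ k f x) (Δ k g x))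
  where
  interchange : ∀ a b c d → a ℤ.+ b ℤ.- (c ℤ.+ d) ≡ a ℤ.- c ℤ.+ (b ℤ.- d)
  interchange = solve-∀ᶻ

Δ-* : ∀ k c f x → Δ k (λ y → c ℤ.* f y) x ≡ c ℤ.* Δ k f x
Δ-* zero    c f x = refl
Δ-* (suc k) c f x = trans (cong₂ ℤ._-_ (Δ-* k c f (suc x)) (Δ-* k c f x)) (factor c _ (Δ k f x))
  where
  factor : ∀ c a b → c ℤ.* a ℤ.- c ℤ.* b ≡ c ℤ.* (a ℤ.- b)
  factor = solve-∀ᶻ

Δ-Δ : ∀ k m f x → Δ k (Δ m f) x ≡ Δ (k + m) f x
Δ-Δ zero    m f x = refl
Δ-Δ (suc k) m f x = cong₂ ℤ._-_ (Δ-Δ k m f (suc x)) (Δ-Δ k m f x)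

Δ-sumBelow : ∀ k n (h : ℕ → ℕ → ℤ) x →
             Δ k (λ y → sumBelow n (λ i → h i y)) x ≡ sumBelow n (λ i → Δ k (h i) x)
Δ-sumBelow k zero    h x = Δ-0 k x
Δ-sumBelow k (suc n) h x = trans (Δ-+ k _ (h n) x) (cong (ℤ._+ Δ k (h n) x) (Δ-sumBelow k n h x))

Δ-suc : ∀ k f x → Δ k f (suc x) ≡ Δ (suc k) f x ℤ.+ Δ k f x
Δ-suc k f x = cancel (Δ k f (suc x)) (Δ k f x)
  where
  cancel : ∀ a b → a ≡ a ℤ.- b ℤ.+ b
  cancel = solve-∀ᶻ

-- The Leibniz rule: second and higher differences of the identity vanish, which leaves two terms.
Δ-id* : ∀ k f x →
        Δ (suc k) (λ y → + y ℤ.* f y) x ≡ + x ℤ.* Δ (suc k) f x ℤ.+ + suc k ℤ.* Δ k f (suc x)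
Δ-id* zero    f x = base (+ x) (f (suc x)) (f x)
  where
  base : ∀ x a b → (1ℤ ℤ.+ x) ℤ.* a ℤ.- x ℤ.* b ≡ x ℤ.* (a ℤ.- b) ℤ.+ 1ℤ ℤ.* a
  base = solve-∀ᶻ
Δ-id* (suc k) f x = trans (cong₂ ℤ._-_ (Δ-id* k f (suc x)) (Δ-id* k f x))
  (step (+ x) (+ k) (Δ (suc k) f x) (Δ k f (suc (suc x))) (Δ k f (suc x)))
  where
  step : ∀ x k b c d →
         (1ℤ ℤ.+ x) ℤ.* (c ℤ.- d) ℤ.+ (1ℤ ℤ.+ k) ℤ.* c ℤ.- (x ℤ.* b ℤ.+ (1ℤ ℤ.+ k) ℤ.* d) ≡
         x ℤ.* (c ℤ.- d ℤ.- b) ℤ.+ (1ℤ ℤ.+ (1ℤ ℤ.+ k)) ℤ.* (c ℤ.- d)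
  step = solve-∀ᶻ

-- Induction on `m` with `x` varying: expand at `suc x`, move each difference back to `x` by
-- `Δ-suc`, and collect with Pascal's rule.
newton : ∀ m f x → f (x + m) ≡ sumBelow (suc m) (λ k → + (m C k) ℤ.* Δ k f x)
newton zero    f x = trans (cong f (+-identityʳ x)) (sym (trans (ℤ.+-identityˡ _) (ℤ.*-identityˡ (f x))))
newton (suc m) f x = begin
  f (x + suc m)
    ≡⟨ cong f (+-suc x m) ⟩
  f (suc x + m)
    ≡⟨ newton m f (suc x) ⟩
  sumBelow (suc m) (λ k → + (m C k) ℤ.* Δ k f (suc x))
    ≡⟨ sumBelow-cong (suc m) (λ {k} _ →
         trans (cong (+ (m C k) ℤ.*_) (Δ-suc k f x)) (ℤ.*-distribˡ-+ (+ (m C k)) _ _)) ⟩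
  sumBelow (suc m) (λ k → + (m C k) ℤ.* d (suc k) ℤ.+ + (m C k) ℤ.* d k)
    ≡⟨ sumBelow-+ (suc m) _ _ ⟩
  u ℤ.+ sumBelow (suc m) (λ k → + (m C k) ℤ.* d k)
    ≡⟨ cong (λ s → u ℤ.+ s) (begin
       sumBelow (suc m) (λ k → + (m C k) ℤ.* d k)
         -- Appending the index m + 1, whose coefficient C(m, m+1) is zero, makes room for splitting
         -- off k = 0.
         ≡⟨ ℤ.+-identityʳ _ ⟨
       sumBelow (suc m) (λ k → + (m C k) ℤ.* d k) ℤ.+ 0ℤ ℤ.* d (suc m)
         ≡⟨ cong (λ c → sumBelow (suc m) (λ k → + (m C k) ℤ.* d k) ℤ.+ + c ℤ.* d (suc m)) (k>n⇒nCk≡0 (n<1+n m)) ⟨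
       sumBelow (suc (suc m)) (λ k → + (m C k) ℤ.* d k)
         ≡⟨ sumBelow-suc (suc m) _ ⟩
       1ℤ ℤ.* d 0 ℤ.+ v ∎) ⟩
  u ℤ.+ (1ℤ ℤ.* d 0 ℤ.+ v)
    ≡⟨ swap u (1ℤ ℤ.* d 0) v ⟩
  1ℤ ℤ.* d 0 ℤ.+ (u ℤ.+ v)
    ≡⟨ cong (λ s → 1ℤ ℤ.* d 0 ℤ.+ s) (begin
       u ℤ.+ v
         ≡⟨ sumBelow-+ (suc m) _ _ ⟨
       sumBelow (suc m) (λ k → + (m C k) ℤ.* d (suc k) ℤ.+ + (m C suc k) ℤ.* d (suc k))
         ≡⟨ sumBelow-cong (suc m) (λ {k} _ → trans (sym (ℤ.*-distribʳ-+ (d (suc k)) (+ (m C k)) (+ (m C suc k))))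
              (cong (λ c → + c ℤ.* d (suc k)) (nCk+nC[k+1]≡[n+1]C[k+1] m k))) ⟩
       sumBelow (suc m) (λ k → + (suc m C suc k) ℤ.* d (suc k)) ∎) ⟩
  1ℤ ℤ.* d 0 ℤ.+ sumBelow (suc m) (λ k → + (suc m C suc k) ℤ.* d (suc k))
    ≡⟨ sumBelow-suc (suc m) (λ k → + (suc m C k) ℤ.* d k) ⟨
  sumBelow (suc (suc m)) (λ k → + (suc m C k) ℤ.* d k) ∎
  where
  open ≡-Reasoning
  d : ℕ → ℤ
  d k = Δ k f x
  u = sumBelow (suc m) (λ k → + (m C k) ℤ.* d (suc k))
  v = sumBelow (suc m) (λ k → + (m C suc k) ℤ.* d (suc k))
  swap : ∀ a b c → a ℤ.+ (b ℤ.+ c) ≡ b ℤ.+ (a ℤ.+ c)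
  swap = solve-∀ᶻ

-- surj n j = j! S(n,j), the number of surjections from an n-set onto a j-set.
surj : ℕ → ℕ → ℤ
surj n j = Δ j (λ x → (+ x) ℤ.^ n) 0

surj-zero : ∀ n → surj (suc n) 0 ≡ 0ℤ
surj-zero n = ℤ.*-zeroˡ (0ℤ ℤ.^ n)

-- The Leibniz rule at 0, applied to x^(n+1) = x · x^n.
surj-suc : ∀ n j → surj (suc n) (suc j) ≡ + suc j ℤ.* (surj n (suc j) ℤ.+ surj n j)
surj-suc n j = begin
  surj (suc n) (suc j)                           ≡⟨ Δ-id* j pow 0 ⟩
  0ℤ ℤ.* Δ (suc j) pow 0 ℤ.+ + suc j ℤ.* Δ j pow 1
    ≡⟨ cong₂ ℤ._+_ (ℤ.*-zeroˡ (Δ (suc j) pow 0)) (cong (+ suc j ℤ.*_) (Δ-suc j pow 0)) ⟩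
  0ℤ ℤ.+ + suc j ℤ.* (surj n (suc j) ℤ.+ surj n j)  ≡⟨ ℤ.+-identityˡ _ ⟩
  + suc j ℤ.* (surj n (suc j) ℤ.+ surj n j)        ∎
  where
  open ≡-Reasoning
  pow : ℕ → ℤ
  pow x = (+ x) ℤ.^ n

-- In a geometric progression of ratio 1 + x, each difference pulls out a factor x.
Δ-^ : ∀ k x y → Δ k ((1ℤ ℤ.+ x) ℤ.^_) y ≡ x ℤ.^ k ℤ.* (1ℤ ℤ.+ x) ℤ.^ y
Δ-^ zero    x y = sym (ℤ.*-identityˡ _)
Δ-^ (suc k) x y = trans (cong₂ ℤ._-_ (Δ-^ k x (suc y)) (Δ-^ k x y)) (step x (x ℤ.^ k) ((1ℤ ℤ.+ x) ℤ.^ y))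
  where
  step : ∀ x a b → a ℤ.* ((1ℤ ℤ.+ x) ℤ.* b) ℤ.- a ℤ.* b ≡ x ℤ.* a ℤ.* b
  step = solve-∀ᶻ

-- Newton's formula for y ↦ (1 + x)^y, whose k-th difference at 0 is x^k.
Δ-power : ∀ n x → Δ 1 (λ y → (+ y) ℤ.^ n) x ≡ sumBelow n (λ i → + (n C i) ℤ.* (+ x) ℤ.^ i)
Δ-power n x = begin
  (+ suc x) ℤ.^ n ℤ.- (+ x) ℤ.^ n
    ≡⟨ cong (ℤ._- (+ x) ℤ.^ n) (newton n ((1ℤ ℤ.+ + x) ℤ.^_) 0) ⟩
  sumBelow n (λ i → + (n C i) ℤ.* Δ i ((1ℤ ℤ.+ + x) ℤ.^_) 0) ℤ.+ + (n C n) ℤ.* Δ n ((1ℤ ℤ.+ + x) ℤ.^_) 0 ℤ.- (+ x) ℤ.^ n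
    ≡⟨ cong₂ (λ s t → s ℤ.+ t ℤ.- (+ x) ℤ.^ n)
         (sumBelow-cong n (λ {i} _ → cong (+ (n C i) ℤ.*_) (at0 i)))
         (cong₂ (λ c t → + c ℤ.* t) (nCn≡1 n) (at0 n)) ⟩
  sumBelow n (λ i → + (n C i) ℤ.* (+ x) ℤ.^ i) ℤ.+ 1ℤ ℤ.* (+ x) ℤ.^ n ℤ.- (+ x) ℤ.^ n
    ≡⟨ cancel _ ((+ x) ℤ.^ n) ⟩
  sumBelow n (λ i → + (n C i) ℤ.* (+ x) ℤ.^ i) ∎
  where
  open ≡-Reasoning
  at0 : ∀ i → Δ i ((1ℤ ℤ.+ + x) ℤ.^_) 0 ≡ (+ x) ℤ.^ i
  at0 i = trans (Δ-^ i (+ x) 0) (ℤ.*-identityʳ _)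
  cancel : ∀ a b → a ℤ.+ 1ℤ ℤ.* b ℤ.- b ≡ a
  cancel = solve-∀ᶻ

-- One difference turns x^n into Σ_{i<n} C(n,i) x^i, and the other `j` act termwise. For
-- surjections, n - i is the size of the fibre over one chosen value, whence i < n.
surj-binomial : ∀ n j → surj n (suc j) ≡ sumBelow n (λ i → + (n C i) ℤ.* surj i j)
surj-binomial n j = begin
  surj n (suc j)
    ≡⟨ cong (surj n) (+-comm 1 j) ⟩
  surj n (j + 1)
    ≡⟨ Δ-Δ j 1 (λ x → (+ x) ℤ.^ n) 0 ⟨
  Δ j (Δ 1 (λ x → (+ x) ℤ.^ n)) 0
    ≡⟨ Δ-cong j (Δ-power n) 0 ⟩
  Δ j (λ x → sumBelow n (λ i → + (n C i) ℤ.* (+ x) ℤ.^ i)) 0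
    ≡⟨ Δ-sumBelow j n _ 0 ⟩
  sumBelow n (λ i → Δ j (λ x → + (n C i) ℤ.* (+ x) ℤ.^ i) 0)
    ≡⟨ sumBelow-cong n (λ {i} _ → Δ-* j (+ (n C i)) (λ x → (+ x) ℤ.^ i) 0) ⟩
  sumBelow n (λ i → + (n C i) ℤ.* surj i j) ∎
  where open ≡-Reasoning

sumBelow-0 : ∀ n → sumBelow n (λ _ → 0ℤ) ≡ 0ℤ
sumBelow-0 zero    = refl
sumBelow-0 (suc n) = trans (ℤ.+-identityʳ _) (sumBelow-0 n)

-- Every summand of `surj-binomial` has i < n ≤ j and so vanishes by recursion.
n<j⇒surj≡0 : ∀ {n j} → n < j → surj n j ≡ 0ℤ
n<j⇒surj≡0 {n} {suc j} (s≤s n≤j) = begin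
  surj n (suc j)                               ≡⟨ surj-binomial n j ⟩
  sumBelow n (λ i → + (n C i) ℤ.* surj i j)    ≡⟨ sumBelow-cong n (λ {i} i<n →
                                                   trans (cong (+ (n C i) ℤ.*_) (n<j⇒surj≡0 (<-≤-trans i<n n≤j)))
                                                         (ℤ.*-zeroʳ (+ (n C i)))) ⟩
  sumBelow n (λ _ → 0ℤ)                        ≡⟨ sumBelow-0 n ⟩
  0ℤ                                           ∎
  where open ≡-Reasoning

-- Adjoint to the passage from the n-th to the (n+1)-st row of Eulerian numbers.
Θ : ℕ → (ℕ → ℤ) → ℕ → ℤ
Θ n f k = (1ℤ ℤ.+ + k) ℤ.* f k ℤ.+ (+ n ℤ.- + k) ℤ.* f (suc k)

-- Write Θ n f as (1 + n) f + n Δf - x Δf. By the Leibniz rule at 0, the last part yields k (Δ^(k+1)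
-- f + Δ^k f), and for n = j + k all multiples of k cancel.
Δ-Θ : ∀ j k f → Δ k (Θ (j + k) f) 0 ≡ + suc j ℤ.* Δ k f 0 ℤ.+ + j ℤ.* Δ (suc k) f 0
Δ-Θ j k f = begin
  Δ k (Θ (j + k) f) 0
    ≡⟨ Δ-cong k (λ x → expand (+ (j + k)) (+ x) (f x) (f (suc x))) 0 ⟩
  Δ k (λ x → + suc (j + k) ℤ.* f x ℤ.+ (+ (j + k) ℤ.* Δ 1 f x ℤ.+ -1ℤ ℤ.* (+ x ℤ.* Δ 1 f x))) 0
    ≡⟨ Δ-+ k _ _ 0 ⟩
  Δ k (λ x → + suc (j + k) ℤ.* f x) 0 ℤ.+ Δ k (λ x → + (j + k) ℤ.* Δ 1 f x ℤ.+ -1ℤ ℤ.* (+ x ℤ.* Δ 1 f x)) 0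
    ≡⟨ cong₂ ℤ._+_ (Δ-* k (+ suc (j + k)) f 0) (trans (Δ-+ k _ _ 0)
         (cong₂ ℤ._+_ (trans (Δ-* k (+ (j + k)) (Δ 1 f) 0) (cong (+ (j + k) ℤ.*_) (Δ-Δ1 0)))
                      (trans (Δ-* k -1ℤ (λ x → + x ℤ.* Δ 1 f x) 0) (cong (-1ℤ ℤ.*_) (Δ-idΔ k))))) ⟩
  + suc (j + k) ℤ.* Δ k f 0 ℤ.+ (+ (j + k) ℤ.* Δ (suc k) f 0 ℤ.+ -1ℤ ℤ.* (+ k ℤ.* (Δ (suc k) f 0 ℤ.+ Δ k f 0)))
    ≡⟨ collect (+ j) (+ k) (Δ k f 0) (Δ (suc k) f 0) ⟩
  + suc j ℤ.* Δ k f 0 ℤ.+ + j ℤ.* Δ (suc k) f 0 ∎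
  where
  open ≡-Reasoning
  expand : ∀ n x a b → (1ℤ ℤ.+ x) ℤ.* a ℤ.+ (n ℤ.- x) ℤ.* b ≡
                       (1ℤ ℤ.+ n) ℤ.* a ℤ.+ (n ℤ.* (b ℤ.- a) ℤ.+ -1ℤ ℤ.* (x ℤ.* (b ℤ.- a)))
  expand = solve-∀ᶻ
  collect : ∀ j k a b → (1ℤ ℤ.+ (j ℤ.+ k)) ℤ.* a ℤ.+ ((j ℤ.+ k) ℤ.* b ℤ.+ -1ℤ ℤ.* (k ℤ.* (b ℤ.+ a))) ≡
                        (1ℤ ℤ.+ j) ℤ.* a ℤ.+ j ℤ.* b
  collect = solve-∀ᶻ
  Δ-Δ1 : ∀ x → Δ k (Δ 1 f) x ≡ Δ (suc k) f x
  Δ-Δ1 x = trans (Δ-Δ k 1 f x) (cong (λ i → Δ i f x) (+-comm k 1))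
  Δ-idΔ : ∀ k → Δ k (λ x → + x ℤ.* Δ 1 f x) 0 ≡ + k ℤ.* (Δ (suc k) f 0 ℤ.+ Δ k f 0)
  Δ-idΔ zero    = trans (ℤ.*-zeroˡ (Δ 1 f 0)) (sym (ℤ.*-zeroˡ (Δ 1 f 0 ℤ.+ Δ 0 f 0)))
  Δ-idΔ (suc k) = begin
    Δ (suc k) (λ x → + x ℤ.* Δ 1 f x) 0
      ≡⟨ Δ-id* k (Δ 1 f) 0 ⟩
    0ℤ ℤ.* Δ (suc k) (Δ 1 f) 0 ℤ.+ + suc k ℤ.* Δ k (Δ 1 f) 1
      ≡⟨ cong₂ ℤ._+_ (ℤ.*-zeroˡ (Δ (suc k) (Δ 1 f) 0)) (cong (+ suc k ℤ.*_)
           (trans (Δ-Δ k 1 f 1) (cong (λ i → Δ i f 1) (+-comm k 1)))) ⟩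
    0ℤ ℤ.+ + suc k ℤ.* Δ (suc k) f 1
      ≡⟨ trans (ℤ.+-identityˡ _) (cong (+ suc k ℤ.*_) (Δ-suc (suc k) f 0)) ⟩
    + suc k ℤ.* (Δ (suc (suc k)) f 0 ℤ.+ Δ (suc k) f 0) ∎

-- Eulerian numbers

sumOver : ∀ {A : Set} → List A → (A → ℤ) → ℤ
sumOver []       f = 0ℤ
sumOver (x ∷ xs) f = f x ℤ.+ sumOver xs f

sumOver-cong : ∀ {A : Set} {xs : List A} {f g} → All (λ x → f x ≡ g x) xs → sumOver xs f ≡ sumOver xs g
sumOver-cong []         = refl
sumOver-cong (eq ∷ eqs) = cong₂ ℤ._+_ eq (sumOver-cong eqs)

sumOver-map : ∀ {A B : Set} (h : A → B) xs f → sumOver (map h xs) f ≡ sumOver xs (f ∘ h)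
sumOver-map h []       f = refl
sumOver-map h (x ∷ xs) f = cong (λ s → f (h x) ℤ.+ s) (sumOver-map h xs f)

sumOver-++ : ∀ {A : Set} (xs ys : List A) f → sumOver (xs ++ ys) f ≡ sumOver xs f ℤ.+ sumOver ys f
sumOver-++ []       ys f = sym (ℤ.+-identityˡ _)
sumOver-++ (x ∷ xs) ys f = trans (cong (λ s → f x ℤ.+ s) (sumOver-++ xs ys f)) (sym (ℤ.+-assoc (f x) _ _))

sumOver-concatMap : ∀ {A B : Set} (h : A → List B) xs f →
                    sumOver (concatMap h xs) f ≡ sumOver xs (λ x → sumOver (h x) f)
sumOver-concatMap h []       f = refl
sumOver-concatMap h (x ∷ xs) f =
  trans (sumOver-++ (h x) (concatMap h xs) f) (cong (λ s → sumOver (h x) f ℤ.+ s) (sumOver-concatMap h xs f))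

ascents-max-∷ : ∀ {x y} ys → y < x → ascents (x ∷ y ∷ ys) ≡ ascents (y ∷ ys)
ascents-max-∷ {x} {y} ys y<x =
  cong (λ b → (if b then 1 else 0) + ascents (y ∷ ys)) (dec-false (x ℕ.<? y) (<-asym y<x))

ascents-∷-max : ∀ {x y} ys → y < x → ascents (y ∷ x ∷ ys) ≡ suc (ascents (x ∷ ys))
ascents-∷-max {x} {y} ys y<x =
  cong (λ b → (if b then 1 else 0) + ascents (x ∷ ys)) (dec-true (y ℕ.<? x) y<x)

-- Of the positions for a new maximum x, those at the front or splitting an ascent keep
-- the number of ascents, the others increase it by one.
sumOver-insertions : ∀ x π f → All (_< x) π →
                     sumOver (insertions x π) (f ∘ ascents) ≡ Θ (length π) f (ascents π)
sumOver-insertions x []           f []            = base (f 0) (f 1)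
  where
  base : ∀ a b → a ℤ.+ 0ℤ ≡ 1ℤ ℤ.* a ℤ.+ 0ℤ ℤ.* b
  base = solve-∀ᶻ
sumOver-insertions x (y ∷ [])     f (y<x ∷ [])    =
  trans (cong₂ (λ i j → f i ℤ.+ (f j ℤ.+ 0ℤ)) (ascents-max-∷ [] y<x) (ascents-∷-max [] y<x)) (base (f 0) (f 1))
  where
  base : ∀ a b → a ℤ.+ (b ℤ.+ 0ℤ) ≡ 1ℤ ℤ.* a ℤ.+ 1ℤ ℤ.* b
  base = solve-∀ᶻ
sumOver-insertions x (y ∷ z ∷ zs) f (y<x ∷ z∷zs<x@(z<x ∷ _)) = begin
  f (ascents (x ∷ y ∷ z ∷ zs)) ℤ.+ (f (ascents (y ∷ x ∷ z ∷ zs)) ℤ.+ rest)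
    ≡⟨ cong₂ (λ i j → f i ℤ.+ (f j ℤ.+ rest)) (ascents-max-∷ (z ∷ zs) y<x)
         (trans (ascents-∷-max (z ∷ zs) y<x) (cong suc (ascents-max-∷ zs z<x))) ⟩
  f (δ + a) ℤ.+ (f (suc a) ℤ.+ rest)
    -- Placing `x` before `y` gives the same value as placing it in front of `z ∷ zs` under the
    -- shifted function `f (δ + i)`. The induction hypothesis for that function thus covers every
    -- position except the one between `y` and `z`.
    ≡⟨ combine (does (y ℕ.<? z)) rest (begin
         f (δ + a) ℤ.+ rest
           ≡⟨ cong₂ (λ i r → f (δ + i) ℤ.+ r) (sym (ascents-max-∷ zs z<x))
                (trans (sumOver-map (y ∷_) (map (z ∷_) (insertions x zs)) _)
                  (trans (sumOver-map (z ∷_) (insertions x zs) _) (sym (sumOver-map (z ∷_) (insertions x zs) _)))) ⟩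
         sumOver (insertions x (z ∷ zs)) (λ ρ → f (δ + ascents ρ))
           ≡⟨ sumOver-insertions x (z ∷ zs) (λ i → f (δ + i)) z∷zs<x ⟩
         Θ (suc n) (λ i → f (δ + i)) a ∎) ⟩
  Θ (suc (suc n)) f (δ + a) ∎
  where
  open ≡-Reasoning
  n = length zs
  a = ascents (z ∷ zs)
  δ = if does (y ℕ.<? z) then 1 else 0
  rest = sumOver (map (y ∷_) (map (z ∷_) (insertions x zs))) (f ∘ ascents)
  -- Inserting between `y` and `z` creates an ascent if `b` is false and splits one if `b` is true;
  -- accordingly `f (suc a)` joins the second or the first coefficient of `Θ`.
  combine : ∀ b r → let δ = if b then 1 else 0 in
            f (δ + a) ℤ.+ r ≡ Θ (suc n) (λ i → f (δ + i)) a →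
            f (δ + a) ℤ.+ (f (suc a) ℤ.+ r) ≡ Θ (suc (suc n)) f (δ + a)
  combine false r eq = trans (swap (f a) (f (suc a)) r) (trans (cong (λ s → f (suc a) ℤ.+ s) eq)
    (collect (+ suc n) (+ a) (f a) (f (suc a))))
    where
    swap : ∀ u v r → u ℤ.+ (v ℤ.+ r) ≡ v ℤ.+ (u ℤ.+ r)
    swap = solve-∀ᶻ
    collect : ∀ n a u v → v ℤ.+ ((1ℤ ℤ.+ a) ℤ.* u ℤ.+ (n ℤ.- a) ℤ.* v) ≡
                          (1ℤ ℤ.+ a) ℤ.* u ℤ.+ (1ℤ ℤ.+ n ℤ.- a) ℤ.* v
    collect = solve-∀ᶻ
  combine true  r eq = trans (cong (λ s → f (suc a) ℤ.+ s) eq)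
    (collect (+ suc n) (+ a) (f (suc a)) (f (suc (suc a))))
    where
    collect : ∀ n a u v → u ℤ.+ ((1ℤ ℤ.+ a) ℤ.* u ℤ.+ (n ℤ.- a) ℤ.* v) ≡
                          (1ℤ ℤ.+ (1ℤ ℤ.+ a)) ℤ.* u ℤ.+ (1ℤ ℤ.+ n ℤ.- (1ℤ ℤ.+ a)) ℤ.* v
    collect = solve-∀ᶻ

All-insertions : ∀ {P : ℕ → Set} x π → P x → All P π →
                 All (λ ρ → All P ρ × length ρ ≡ suc (length π)) (insertions x π)
All-insertions x []      px []         = (px ∷ [] , refl) ∷ []
All-insertions x (y ∷ π) px (py ∷ pπ) =
  (px ∷ py ∷ pπ , refl) ∷ All.map⁺ (All.map (λ (pρ , eq) → py ∷ pρ , cong suc eq) (All-insertions x π px pπ))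

-- Provides what `sumOver-insertions` asks of the next entry `suc n`: that it is a new maximum, and
-- which length enters `Θ`.
All-perms : ∀ n → All (λ π → All (_< suc n) π × length π ≡ n) (perms (oneTo n))
All-perms zero    = ([] , refl) ∷ []
All-perms (suc n) = All.concat⁺ (All.map⁺ (All.map
  (λ {π} (π< , eq) → All.map (λ (ρ< , eq′) → ρ< , trans eq′ (cong suc eq))
    (All-insertions (suc n) π (n<1+n (suc n)) (All.map m<n⇒m<1+n π<)))
  (All-perms n)))

ascents≤ : ∀ y ys → ascents (y ∷ ys) ≤ length ys
ascents≤ y []       = z≤n
ascents≤ y (z ∷ zs) = +-mono-≤ {y = 1} (bit (does (y ℕ.<? z))) (ascents≤ z zs)
  where
  bit : ∀ b → (if b then 1 else 0) ≤ 1
  bit false = z≤n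
  bit true  = ≤-refl

-- The pairing of the n-th Eulerian row with `f`, summed over permutations instead of ascent numbers
-- so that the insertion recursion applies directly.
ascentSum : ℕ → (ℕ → ℤ) → ℤ
ascentSum n f = sumOver (perms (oneTo n)) (f ∘ ascents)

ascentSum-suc : ∀ n f → ascentSum (suc n) f ≡ ascentSum n (Θ n f)
ascentSum-suc n f = trans (sumOver-concatMap (insertions (suc n)) (perms (oneTo n)) (f ∘ ascents))
  (sumOver-cong (All.map
    (λ {π} (π< , eq) → trans (sumOver-insertions (suc n) π f π<) (cong (λ m → Θ m f (ascents π)) eq))
    (All-perms n)))

-- In terms of Eulerian polynomials: A_n(x) = Σ_j surj n j (x - 1)^{n-j}.
ascentSum-Δ : ∀ n f → ascentSum n f ≡ sumBelow (suc n) (λ j → surj n j ℤ.* Δ (n ∸ j) f 0)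
ascentSum-Δ zero    f = base (f 0)
  where
  base : ∀ a → a ℤ.+ 0ℤ ≡ 0ℤ ℤ.+ 1ℤ ℤ.* a
  base = solve-∀ᶻ
ascentSum-Δ (suc n) f = begin
  ascentSum (suc n) f
    ≡⟨ ascentSum-suc n f ⟩
  ascentSum n (Θ n f)
    ≡⟨ ascentSum-Δ n (Θ n f) ⟩
  sumBelow (suc n) (λ j → surj n j ℤ.* Δ (n ∸ j) (Θ n f) 0)
    ≡⟨ sumBelow-cong (suc n) (λ {j} j≤n → expand j (≤-pred j≤n)) ⟩
  sumBelow (suc n) (λ j → + suc j ℤ.* surj n j ℤ.* d j ℤ.+ g j)
    ≡⟨ sumBelow-+ (suc n) _ g ⟩
  sumBelow (suc n) (λ j → + suc j ℤ.* surj n j ℤ.* d j) ℤ.+ sumBelow (suc n) g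
    -- Shifting `g` by one index makes both sums multiples of `d j`. Nothing is lost at the ends:
    -- `g 0` has the factor 0 and `g (suc n)` the factor `surj n (suc n)`, which is 0.
    ≡⟨ cong (λ s → sumBelow (suc n) (λ j → + suc j ℤ.* surj n j ℤ.* d j) ℤ.+ s) shift-g ⟩
  sumBelow (suc n) (λ j → + suc j ℤ.* surj n j ℤ.* d j) ℤ.+ sumBelow (suc n) (g ∘ suc)
    ≡⟨ sumBelow-+ (suc n) _ (g ∘ suc) ⟨
  sumBelow (suc n) (λ j → + suc j ℤ.* surj n j ℤ.* d j ℤ.+ g (suc j))
    ≡⟨ sumBelow-cong (suc n) (λ {j} _ → trans (factor (+ suc j) (surj n j) (surj n (suc j)) (d j))
         (cong (ℤ._* d j) (sym (surj-suc n j)))) ⟩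
  sumBelow (suc n) (λ j → surj (suc n) (suc j) ℤ.* d j)
    ≡⟨ trans (cong (ℤ._+ sumBelow (suc n) (λ j → surj (suc n) (suc j) ℤ.* d j))
         (trans (cong (ℤ._* Δ (suc n) f 0) (surj-zero n)) (ℤ.*-zeroˡ (Δ (suc n) f 0)))) (ℤ.+-identityˡ _) ⟨
  surj (suc n) 0 ℤ.* Δ (suc n) f 0 ℤ.+ sumBelow (suc n) (λ j → surj (suc n) (suc j) ℤ.* d j)
    ≡⟨ sumBelow-suc (suc n) (λ j → surj (suc n) j ℤ.* Δ (suc n ∸ j) f 0) ⟨
  sumBelow (suc (suc n)) (λ j → surj (suc n) j ℤ.* Δ (suc n ∸ j) f 0) ∎
  where
  open ≡-Reasoning
  d g : ℕ → ℤ
  d j = Δ (n ∸ j) f 0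
  g j = + j ℤ.* surj n j ℤ.* Δ (suc n ∸ j) f 0

  expand : ∀ j → j ≤ n → surj n j ℤ.* Δ (n ∸ j) (Θ n f) 0 ≡ + suc j ℤ.* surj n j ℤ.* d j ℤ.+ g j
  expand j j≤n = begin
    surj n j ℤ.* Δ (n ∸ j) (Θ n f) 0
      -- Splitting n as j + (n - j) brings `Θ n` into the form required by `Δ-Θ`.
      ≡⟨ cong (λ m → surj n j ℤ.* Δ (n ∸ j) (Θ m f) 0) (m+[n∸m]≡n j≤n) ⟨
    surj n j ℤ.* Δ (n ∸ j) (Θ (j + (n ∸ j)) f) 0
      ≡⟨ cong (λ s → surj n j ℤ.* s) (Δ-Θ j (n ∸ j) f) ⟩
    surj n j ℤ.* (+ suc j ℤ.* d j ℤ.+ + j ℤ.* Δ (suc (n ∸ j)) f 0)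
      ≡⟨ cong (λ i → surj n j ℤ.* (+ suc j ℤ.* d j ℤ.+ + j ℤ.* Δ i f 0)) (+-∸-assoc 1 j≤n) ⟨
    surj n j ℤ.* (+ suc j ℤ.* d j ℤ.+ + j ℤ.* Δ (suc n ∸ j) f 0)
      ≡⟨ distrib (surj n j) (+ suc j) (d j) (+ j) (Δ (suc n ∸ j) f 0) ⟩
    + suc j ℤ.* surj n j ℤ.* d j ℤ.+ g j ∎
    where
    distrib : ∀ s a x b y → s ℤ.* (a ℤ.* x ℤ.+ b ℤ.* y) ≡ a ℤ.* s ℤ.* x ℤ.+ b ℤ.* s ℤ.* y
    distrib = solve-∀ᶻ

  factor : ∀ c a b x → c ℤ.* a ℤ.* x ℤ.+ c ℤ.* b ℤ.* x ≡ c ℤ.* (b ℤ.+ a) ℤ.* x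
  factor = solve-∀ᶻ

  zero-term : ∀ {a b} c → a ≡ 0ℤ → b ℤ.* a ℤ.* c ≡ 0ℤ
  zero-term {b = b} c refl = trans (cong (ℤ._* c) (ℤ.*-zeroʳ b)) (ℤ.*-zeroˡ c)

  shift-g : sumBelow (suc n) g ≡ sumBelow (suc n) (g ∘ suc)
  shift-g = begin
    sumBelow (suc n) g
      ≡⟨ ℤ.+-identityʳ _ ⟨
    sumBelow (suc n) g ℤ.+ 0ℤ
      ≡⟨ cong (λ s → sumBelow (suc n) g ℤ.+ s) (zero-term {b = + suc n} (Δ (n ∸ n) f 0) (n<j⇒surj≡0 (n<1+n n))) ⟨
    sumBelow (suc (suc n)) g
      ≡⟨ sumBelow-suc (suc n) g ⟩
    g 0 ℤ.+ sumBelow (suc n) (g ∘ suc)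
      ≡⟨ cong (ℤ._+ sumBelow (suc n) (g ∘ suc))
           (trans (cong (ℤ._* Δ (suc n) f 0) (ℤ.*-zeroˡ (surj n 0))) (ℤ.*-zeroˡ (Δ (suc n) f 0))) ⟩
    0ℤ ℤ.+ sumBelow (suc n) (g ∘ suc)
      ≡⟨ ℤ.+-identityˡ _ ⟩
    sumBelow (suc n) (g ∘ suc) ∎

sumBelow-indicator : ∀ n (f : ℕ → ℤ) {a} → a < n → sumBelow n (λ k → + (if does (a ℕ.≟ k) then 1 else 0) ℤ.* f k) ≡ f a
sumBelow-indicator (suc n) f {a} a≤n with a ℕ.≟ n
... | yes refl = begin
    sumBelow n (λ k → + (if does (n ℕ.≟ k) then 1 else 0) ℤ.* f k) ℤ.+ + (if does (n ℕ.≟ n) then 1 else 0) ℤ.* f n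
      ≡⟨ cong₂ (λ s b → s ℤ.+ + (if b then 1 else 0) ℤ.* f n)
           (trans (sumBelow-cong n (λ {k} k<n → trans
             (cong (λ b → + (if b then 1 else 0) ℤ.* f k) (dec-false (n ℕ.≟ k) (≢-sym (<⇒≢ k<n)))) (ℤ.*-zeroˡ (f k))))
             (sumBelow-0 n))
           (dec-true (n ℕ.≟ n) refl) ⟩
    0ℤ ℤ.+ 1ℤ ℤ.* f n
      ≡⟨ trans (ℤ.+-identityˡ _) (ℤ.*-identityˡ (f n)) ⟩
    f n ∎
  where open ≡-Reasoning
... | no a≢n = trans
    (cong₂ (λ s b → s ℤ.+ + (if b then 1 else 0) ℤ.* f n)
      (sumBelow-indicator n f (≤∧≢⇒< (≤-pred a≤n) a≢n)) (dec-false (a ℕ.≟ n) a≢n))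
    (trans (cong (λ s → f a ℤ.+ s) (ℤ.*-zeroˡ (f n))) (ℤ.+-identityʳ (f a)))

-- Exchange of summations: each list is counted for exactly one `k`, which the bound puts in range.
sumBelow-length-filter : ∀ n (f : ℕ → ℤ) {πs} → All (λ π → ascents π < n) πs →
  sumBelow n (λ k → + length (filter (λ π → ascents π ℕ.≟ k) πs) ℤ.* f k) ≡ sumOver πs (f ∘ ascents)
sumBelow-length-filter n f {[]}     []          =
  trans (sumBelow-cong n (λ {k} _ → ℤ.*-zeroˡ (f k))) (sumBelow-0 n)
sumBelow-length-filter n f {π ∷ πs} (lt ∷ lts) = begin
  sumBelow n (λ k → + count k (π ∷ πs) ℤ.* f k)
    ≡⟨ sumBelow-cong n (λ {k} _ → trans (cong (λ c → + c ℤ.* f k) (count-∷ k))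
         (ℤ.*-distribʳ-+ (f k) (+ (if does (ascents π ℕ.≟ k) then 1 else 0)) (+ count k πs))) ⟩
  sumBelow n (λ k → + (if does (ascents π ℕ.≟ k) then 1 else 0) ℤ.* f k ℤ.+ + count k πs ℤ.* f k)
    ≡⟨ sumBelow-+ n _ _ ⟩
  sumBelow n (λ k → + (if does (ascents π ℕ.≟ k) then 1 else 0) ℤ.* f k) ℤ.+ sumBelow n (λ k → + count k πs ℤ.* f k)
    ≡⟨ cong₂ ℤ._+_ (sumBelow-indicator n f lt) (sumBelow-length-filter n f lts) ⟩
  f (ascents π) ℤ.+ sumOver πs (f ∘ ascents) ∎
  where
  open ≡-Reasoning
  count : ℕ → List (List ℕ) → ℕ
  count k πs = length (filter (λ π → ascents π ℕ.≟ k) πs)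
  count-∷ : ∀ k → count k (π ∷ πs) ≡ (if does (ascents π ℕ.≟ k) then 1 else 0) + count k πs
  count-∷ k with does (ascents π ℕ.≟ k)
  ... | true  = refl
  ... | false = refl

sumBelow-eulerian : ∀ n → 0 < n → ∀ f → sumBelow n (λ k → + eulerian n k ℤ.* f k) ≡ ascentSum n f
sumBelow-eulerian n 0<n f = sumBelow-length-filter n f (All.map (λ {π} (_ , eq) → ascents< π eq) (All-perms n))
  where
  ascents< : ∀ π → length π ≡ n → ascents π < n
  -- Here `n` is 0 and the goal is `0 < 0`, the hypothesis itself: positivity rules this case out.
  ascents< []       refl = 0<n
  ascents< (y ∷ ys) refl = s≤s (ascents≤ y ys)

-- Divisibility by powers of p

-- Used with p^α for `suc n`: it shows that C(p^α, k+1) retains the factors p of p^α that k + 1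
-- lacks.
absorption : ∀ n k → suc k * (suc n C suc k) ≡ suc n * (n C k)
absorption zero zero = refl
absorption zero (suc k) = *-zeroʳ (suc (suc k))
absorption (suc n) zero = begin
  1 * (suc (suc n) C 1)       ≡⟨ *-identityˡ _ ⟩
  suc (suc n) C 1             ≡⟨ nC1≡n (suc (suc n)) ⟩
  suc (suc n)                 ≡⟨ *-identityʳ _ ⟨
  suc (suc n) * (suc n C 0)   ∎
  where open ≡-Reasoning
absorption (suc n) (suc k) = begin
  suc (suc k) * (suc (suc n) C suc (suc k))
    ≡⟨ cong (suc (suc k) *_) (nCk+nC[k+1]≡[n+1]C[k+1] (suc n) (suc k)) ⟨
  suc (suc k) * (a + (suc n C suc (suc k)))
    ≡⟨ expand k a _ ⟩
  suc k * a + a + suc (suc k) * (suc n C suc (suc k))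
    ≡⟨ cong₂ (λ x y → x + a + y) (absorption n k) (absorption n (suc k)) ⟩
  suc n * (n C k) + a + suc n * (n C suc k)
    ≡⟨ collect n (n C k) a (n C suc k) ⟩
  suc n * ((n C k) + (n C suc k)) + a
    ≡⟨ cong (λ x → suc n * x + a) (nCk+nC[k+1]≡[n+1]C[k+1] n k) ⟩
  suc n * a + a
    ≡⟨ +-comm (suc n * a) a ⟩
  suc (suc n) * a ∎
  where
  open ≡-Reasoning
  a = suc n C suc k
  expand : ∀ k a b → suc (suc k) * (a + b) ≡ suc k * a + a + suc (suc k) * b
  expand = solve-∀
  collect : ∀ n x a y → suc n * x + a + suc n * y ≡ suc n * (x + y) + a
  collect = solve-∀

C*!*! : ∀ i m → ((i + m) C i) * (i ! * m !) ≡ (i + m) !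
C*!*! i m = begin
  ((i + m) C i) * (i ! * m !)            ≡⟨ cong (λ j → ((i + m) C i) * (i ! * j !)) (m+n∸m≡n i m) ⟨
  ((i + m) C i) * (i ! * (i + m ∸ i) !)  ≡⟨ cong (_* (i ! * (i + m ∸ i) !)) (nCk≡n!/k![n-k]! (m≤m+n i m)) ⟩
  ((i + m) ! / (i ! * (i + m ∸ i) !)) {{nz}} * (i ! * (i + m ∸ i) !)
                                          ≡⟨ m/n*n≡m {{nz}} (k![n∸k]!∣n! (m≤m+n i m)) ⟩
  (i + m) ! ∎
  where
  open ≡-Reasoning
  nz = i !* (i + m ∸ i) !≢0

/-superadditive : ∀ a b d .{{_ : NonZero d}} → a / d + b / d ≤ (a + b) / d
/-superadditive a b d = subst (_≤ (a + b) / d) (m*n/n≡m (a / d + b / d) d) (/-monoˡ-≤ d (begin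
  (a / d + b / d) * d      ≡⟨ *-distribʳ-+ d (a / d) (b / d) ⟩
  a / d * d + b / d * d    ≤⟨ +-mono-≤ (m/n*n≤m a d) (m/n*n≤m b d) ⟩
  a + b                    ∎))
  where open ≤-Reasoning

∣-sumBelow : ∀ {d} n {f : ℕ → ℤ} → (∀ {k} → k < n → d ℤS.∣ f k) → d ℤS.∣ sumBelow n f
∣-sumBelow zero    d∣f = ℤS.divides 0ℤ refl
∣-sumBelow (suc n) d∣f = ℤS.∣m∣n⇒∣m+n (∣-sumBelow n (d∣f ∘ m<n⇒m<1+n)) (d∣f (n<1+n n))

*-pres-∣ᶻ : ∀ {a b x y} → a ℤS.∣ x → b ℤS.∣ y → a ℤ.* b ℤS.∣ x ℤ.* y
*-pres-∣ᶻ {a} {b} (ℤS.divides q refl) (ℤS.divides r refl) = ℤS.divides (q ℤ.* r) (swap q a r b)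
  where
  swap : ∀ q a r b → q ℤ.* a ℤ.* (r ℤ.* b) ≡ q ℤ.* r ℤ.* (a ℤ.* b)
  swap = solve-∀ᶻ

-- Valuations of factorials and binomial coefficients

module _ {p : ℕ} (p-prime : Prime p) where

  private instance
    p≢0 : NonZero p
    p≢0 = prime⇒nonZero p-prime

  1<p : 1 < p
  1<p = ℕ.nonTrivial⇒n>1 p {{prime⇒nonTrivial p-prime}}

  p∤* : ∀ {u v} → ¬ p ∣ u → ¬ p ∣ v → ¬ p ∣ u * v
  p∤* {u} {v} p∤u p∤v p∣uv with euclidsLemma u v p-prime p∣uv
  ... | inj₁ p∣u = p∤u p∣u
  ... | inj₂ p∣v = p∤v p∣v

  p∤1 : ¬ p ∣ 1
  p∤1 p∣1 = <⇒≢ 1<p (sym (∣1⇒≡1 p∣1))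

  -- By Euclid's lemma one factor p at a time can be moved into `z` and cancelled.
  ^∣-cancel-unit : ∀ e {u z} → ¬ p ∣ u → p ^ e ∣ u * z → p ^ e ∣ z
  ^∣-cancel-unit zero            p∤u _ = 1∣ _
  ^∣-cancel-unit (suc e) {u} {z} p∤u d with euclidsLemma u z p-prime (∣-trans (m∣m*n (p ^ e)) d)
  ... | inj₁ p∣u = contradiction p∣u p∤u
  ... | inj₂ (divides w refl) =
        subst (p ^ suc e ∣_) (*-comm p w)
          (*-monoʳ-∣ p (^∣-cancel-unit e p∤u (*-cancelˡ-∣ p (subst (p ^ suc e ∣_) (swap u w p) d))))
    where
    swap : ∀ u w p → u * (w * p) ≡ p * (u * w)
    swap = solve-∀

  ^∣-cancel-^ : ∀ e a {z} → p ^ e ∣ p ^ a * z → p ^ (e ∸ a) ∣ z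
  ^∣-cancel-^ e       zero    {z} d = subst (p ^ e ∣_) (*-identityˡ z) d
  ^∣-cancel-^ zero    (suc a)     d = 1∣ _
  ^∣-cancel-^ (suc e) (suc a) {z} d =
    ^∣-cancel-^ e a (*-cancelˡ-∣ p (subst (p ^ suc e ∣_) (*-assoc p (p ^ a) z) d))

  ^-monoʳ-∣ : ∀ {a b} → a ≤ b → p ^ a ∣ p ^ b
  ^-monoʳ-∣ {a} {b} a≤b = subst (λ c → p ^ a ∣ p ^ c) (m+[n∸m]≡n a≤b)
    (subst (p ^ a ∣_) (sym (^-distribˡ-+-* p a (b ∸ a))) (m∣m*n _))

  -- Stands in for ord_p: the exponent comes with the cofactor prime to p, ready for cancellation.
  p-part : ∀ m → .{{NonZero m}} → ∃₂ λ e u → m ≡ p ^ e * u × ¬ p ∣ u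
  p-part m = <-rec (λ m → .{{NonZero m}} → ∃₂ λ e u → m ≡ p ^ e * u × ¬ p ∣ u) step m
    where
    step : ∀ m → (∀ {k} → k < m → .{{NonZero k}} → ∃₂ λ e u → k ≡ p ^ e * u × ¬ p ∣ u) →
           .{{NonZero m}} → ∃₂ λ e u → m ≡ p ^ e * u × ¬ p ∣ u
    step m rec with p ∣? m
    ... | no p∤m = 0 , m , sym (*-identityˡ m) , p∤m
    ... | yes p∣m with rec (quotient-< p∣m {{prime⇒nonTrivial p-prime}}) {{quotient≢0 p∣m}}
    ...   | e , u , eq , p∤u = suc e , u , (begin
      m                     ≡⟨ m∣n⇒n≡m*quotient p∣m ⟩
      p * quotient p∣m      ≡⟨ cong (p *_) eq ⟩
      p * (p ^ e * u)       ≡⟨ *-assoc p (p ^ e) u ⟨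
      p ^ suc e * u         ∎) , p∤u
      where open ≡-Reasoning

  -- One step of Legendre's formula: the multiples of p up to m are p, 2p, ..., kp with k = ⌊m/p⌋.
  -- Their product is p^k k!, and `u` collects the other factors.
  !-p-step : ∀ m → ∃[ u ] (m ! ≡ p ^ (m / p) * ((m / p) ! * u) × ¬ p ∣ u)
  !-p-step zero = 1 , subst (λ k → 1 ≡ p ^ k * (k ! * 1)) (sym (0/n≡0 p)) refl , p∤1
  !-p-step (suc m) with p ∣? suc m | !-p-step m
  ... | no p∤ | u , eq , p∤u = suc m * u , (begin
      suc m * m !                              ≡⟨ cong (suc m *_) eq ⟩
      suc m * (p ^ (m / p) * ((m / p) ! * u))  ≡⟨ rearrange (suc m) (p ^ (m / p)) ((m / p) !) u ⟩
      p ^ (m / p) * ((m / p) ! * (suc m * u))  ≡⟨ cong (λ k → p ^ k * (k ! * (suc m * u))) m/p≡ ⟩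
      p ^ (suc m / p) * ((suc m / p) ! * (suc m * u)) ∎) , p∤* p∤ p∤u
    where
    open ≡-Reasoning
    rearrange : ∀ a b c d → a * (b * (c * d)) ≡ b * (c * (a * d))
    rearrange = solve-∀
    m/p≡ : m / p ≡ suc m / p
    m/p≡ = ≤-antisym (/-monoˡ-≤ p (n≤1+n m)) (≮⇒≥ λ lt → p∤ (divides (suc m / p) (≤-antisym
      (≮⇒≥ λ lt′ → <⇒≱ lt (subst (_≤ m / p) (m*n/n≡m (suc m / p) p) (/-monoˡ-≤ p (≤-pred lt′))))
      (m/n*n≤m (suc m) p))))
  ... | yes (divides (suc k) 1+m≡) | u , eq , p∤u = u , (begin
      suc m * m !                                       ≡⟨ cong₂ _*_ 1+m≡ eq ⟩
      suc k * p * (p ^ (m / p) * ((m / p) ! * u))       ≡⟨ cong (λ j → suc k * p * (p ^ j * (j ! * u))) m/p≡k ⟩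
      suc k * p * (p ^ k * (k ! * u))                   ≡⟨ rearrange (suc k) p (p ^ k) (k !) u ⟩
      p ^ suc k * (suc k ! * u)                         ≡⟨ cong (λ j → p ^ j * (j ! * u)) [1+m]/p≡ ⟨
      p ^ (suc m / p) * ((suc m / p) ! * u)             ∎) , p∤u
    where
    open ≡-Reasoning
    rearrange : ∀ a b c d e → a * b * (c * (d * e)) ≡ b * c * (a * d * e)
    rearrange = solve-∀
    [1+m]/p≡ : suc m / p ≡ suc k
    [1+m]/p≡ = trans (/-congˡ 1+m≡) (m*n/n≡m (suc k) p)
    m/p≡k : m / p ≡ k
    m/p≡k = ≤-antisym
      (≤-pred (m<n*o⇒m/o<n (≤-reflexive 1+m≡)))
      (subst (_≤ m / p) (m*n/n≡m k p) (/-monoˡ-≤ p (≤-pred (subst (k * p <_) (sym 1+m≡) (*-monoˡ-< p (n<1+n k))))))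

  -- With k = ⌊m/p⌋ > 0, ord_p(m!) = k + ord_p(k!). By induction (p - 1) times this is less than k
  -- (p - 1) + k = kp ≤ m.
  legendre-bound : ∀ m e → 0 < m → p ^ e ∣ m ! → e * (p ∸ 1) < m
  legendre-bound = <-rec (λ m → ∀ e → 0 < m → p ^ e ∣ m ! → e * (p ∸ 1) < m) step
    where
    e≡0 : ∀ e → p ^ e ∣ 1 → e ≡ 0
    e≡0 zero    _ = refl
    e≡0 (suc e) d = contradiction (∣-trans (m∣m*n (p ^ e)) d) p∤1

    p-1+1 : p ∸ 1 + 1 ≡ p
    p-1+1 = m∸n+n≡m (<⇒≤ 1<p)

    step : ∀ m → (∀ {k} → k < m → ∀ e → 0 < k → p ^ e ∣ k ! → e * (p ∸ 1) < k) →
           ∀ e → 0 < m → p ^ e ∣ m ! → e * (p ∸ 1) < m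
    step m@(suc _) rec e 0<m d with m / p in eq | !-p-step m
    -- For m < p the factorial is prime to p, so `e` is 0.
    ... | zero  | u , m!≡ , p∤u =
          subst (λ e → e * (p ∸ 1) < m)
            (sym (e≡0 e (^∣-cancel-unit e p∤u (subst (p ^ e ∣_) (trans m!≡ (simp u)) d)))) 0<m
      where
      simp : ∀ u → 1 * (1 * u) ≡ u * 1
      simp = solve-∀
    ... | k@(suc _) | u , m!≡ , p∤u = begin-strict
          e * (p ∸ 1)                    ≤⟨ *-monoˡ-≤ (p ∸ 1) (m≤n+m∸n e k) ⟩
          (k + (e ∸ k)) * (p ∸ 1)        ≡⟨ *-distribʳ-+ (p ∸ 1) k (e ∸ k) ⟩
          k * (p ∸ 1) + (e ∸ k) * (p ∸ 1) <⟨ +-monoʳ-< (k * (p ∸ 1)) (rec k<m (e ∸ k) (s≤s z≤n) d′) ⟩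
          k * (p ∸ 1) + k                ≡⟨ cong (λ t → k * (p ∸ 1) + t) (*-identityʳ k) ⟨
          k * (p ∸ 1) + k * 1            ≡⟨ *-distribˡ-+ k (p ∸ 1) 1 ⟨
          k * (p ∸ 1 + 1)                ≡⟨ cong (k *_) p-1+1 ⟩
          k * p                          ≡⟨ cong (_* p) eq ⟨
          m / p * p                      ≤⟨ m/n*n≤m m p ⟩
          m                              ∎
      where
      open ≤-Reasoning
      k<m : k < m
      k<m = subst (_< m) eq (m/n<m m p 1<p)
      d′ : p ^ (e ∸ k) ∣ k !
      d′ = ^∣-cancel-unit (e ∸ k) p∤u (subst (p ^ (e ∸ k) ∣_) (*-comm (k !) u)
             (^∣-cancel-^ e k (subst (p ^ e ∣_) m!≡ d)))

  -- Iterated division by p rather than one division by p^β, so that `!-p-step` relates the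
  -- factorials of consecutive levels.
  ⌊_/p^_⌋ : ℕ → ℕ → ℕ
  ⌊ m /p^ zero  ⌋ = m
  ⌊ m /p^ suc β ⌋ = ⌊ m /p^ β ⌋ / p

  ⌊/p^⌋≡/ : ∀ m β .{{_ : NonZero (p ^ β)}} → ⌊ m /p^ β ⌋ ≡ m / p ^ β
  ⌊/p^⌋≡/ m zero    = sym (n/1≡n m)
  ⌊/p^⌋≡/ m (suc β) = begin
    ⌊ m /p^ β ⌋ / p     ≡⟨ cong (_/ p) (⌊/p^⌋≡/ m β) ⟩
    m / p ^ β / p       ≡⟨ m/n/o≡m/[n*o] m (p ^ β) p ⟩
    m / (p ^ β * p)     ≡⟨ /-congʳ (*-comm (p ^ β) p) ⟩
    m / (p * p ^ β)     ∎
    where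
    open ≡-Reasoning
    instance
      p^β≢0 = m^n≢0 p β
      p^β*p≢0 = m*n≢0 (p ^ β) p

  ⌊/p^⌋-superadditive : ∀ i m β → ⌊ i /p^ β ⌋ + ⌊ m /p^ β ⌋ ≤ ⌊ i + m /p^ β ⌋
  ⌊/p^⌋-superadditive i m zero    = ≤-refl
  ⌊/p^⌋-superadditive i m (suc β) =
    ≤-trans (/-superadditive ⌊ i /p^ β ⌋ ⌊ m /p^ β ⌋ p) (/-monoˡ-≤ p (⌊/p^⌋-superadditive i m β))

  -- Scale Legendre's bound for k = ⌊m/p^β⌋ by p^β and use k p^β ≤ m.
  legendre-bound-⌊/p^⌋ : ∀ β m e → 0 < m → p ^ e ∣ ⌊ m /p^ β ⌋ ! → e * (p ^ β * (p ∸ 1)) < m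
  legendre-bound-⌊/p^⌋ β m e 0<m d with ⌊ m /p^ β ⌋ in eq
  ... | zero = subst (_< m) (sym e*φ≡0) 0<m
    where
    rearrange : ∀ e q r → e * (q * r) ≡ q * (e * r)
    rearrange = solve-∀
    e*φ≡0 : e * (p ^ β * (p ∸ 1)) ≡ 0
    e*φ≡0 = trans (rearrange e (p ^ β) (p ∸ 1)) (trans
      -- Legendre's bound needs a positive argument; 1 will do, as 0! = 1!.
      (cong (p ^ β *_) (n<1⇒n≡0 (legendre-bound 1 e (s≤s z≤n) d)))
      (*-zeroʳ (p ^ β)))
  ... | k@(suc _) = begin-strict
    e * (p ^ β * (p ∸ 1))   ≡⟨ rearrange e (p ^ β) (p ∸ 1) ⟩
    e * (p ∸ 1) * p ^ β     <⟨ *-monoˡ-< (p ^ β) (legendre-bound k e (s≤s z≤n) d) ⟩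
    k * p ^ β               ≡⟨ cong (_* p ^ β) (trans (sym eq) (⌊/p^⌋≡/ m β)) ⟩
    m / p ^ β * p ^ β       ≤⟨ m/n*n≤m m (p ^ β) ⟩
    m                       ∎
    where
    open ≤-Reasoning
    instance
      p^β≢0 = m^n≢0 p β
    rearrange : ∀ e q r → e * (q * r) ≡ e * r * q
    rearrange = solve-∀

  -- For β = 0 the product is (i+m)! itself. Raising β by one removes p^a from the factorial on the
  -- left and p^(b+c) from those on the right, by `!-p-step`; since b + c ≤ a, the right side loses
  -- no more.
  C*⌊/p^⌋!-∣ : ∀ β i m e → p ^ e ∣ ⌊ i + m /p^ β ⌋ ! →
               p ^ e ∣ ((i + m) C i) * (⌊ i /p^ β ⌋ ! * ⌊ m /p^ β ⌋ !)
  C*⌊/p^⌋!-∣ zero    i m e d = subst (p ^ e ∣_) (sym (C*!*! i m)) d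
  C*⌊/p^⌋!-∣ (suc β) i m e d
    with !-p-step ⌊ i + m /p^ β ⌋ | !-p-step ⌊ i /p^ β ⌋ | !-p-step ⌊ m /p^ β ⌋
  ... | u , n!≡ , p∤u | v , i!≡ , p∤v | w , m!≡ , p∤w =
    ∣-trans (^-monoʳ-∣ e≤) (^∣-cancel-^ (a + e) (b + c) cancelled)
    where
    a = ⌊ i + m /p^ suc β ⌋
    b = ⌊ i /p^ suc β ⌋
    c = ⌊ m /p^ suc β ⌋
    k = (i + m) C i
    e≤ : e ≤ a + e ∸ (b + c)
    e≤ = subst (_≤ a + e ∸ (b + c)) (m+n∸m≡n (b + c) e)
           (∸-monoˡ-≤ (b + c) (+-monoˡ-≤ e (⌊/p^⌋-superadditive i m (suc β))))
    raised : p ^ (a + e) ∣ ⌊ i + m /p^ β ⌋ !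
    raised = subst₂ _∣_ (sym (^-distribˡ-+-* p a e)) (sym n!≡) (*-monoʳ-∣ (p ^ a) (∣m⇒∣m*n u d))
    cancelled : p ^ (a + e) ∣ p ^ (b + c) * (k * (b ! * c !))
    cancelled = ^∣-cancel-unit (a + e) (p∤* p∤v p∤w) (subst (p ^ (a + e) ∣_) (begin
      k * (⌊ i /p^ β ⌋ ! * ⌊ m /p^ β ⌋ !)
        ≡⟨ cong₂ (λ x y → k * (x * y)) i!≡ m!≡ ⟩
      k * (p ^ b * (b ! * v) * (p ^ c * (c ! * w)))
        ≡⟨ rearrange k (p ^ b) (b !) v (p ^ c) (c !) w ⟩
      v * w * (p ^ b * p ^ c * (k * (b ! * c !)))
        ≡⟨ cong (λ x → v * w * (x * (k * (b ! * c !)))) (^-distribˡ-+-* p b c) ⟨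
      v * w * (p ^ (b + c) * (k * (b ! * c !))) ∎) (C*⌊/p^⌋!-∣ β i m (a + e) raised))
      where
      open ≡-Reasoning
      rearrange : ∀ k x y v z t w → k * (x * (y * v) * (z * (t * w))) ≡ v * w * (x * z * (k * (y * t)))
      rearrange = solve-∀

  -- p^(t+s) - p^t is the sum of p^(t+i) (p - 1) over i < s, and t + i ≤ β in each term.
  p^[t+s]-bound : ∀ β t s → t + s ≤ suc β → p ^ (t + s) ≤ s * (p ^ β * (p ∸ 1)) + p ^ t
  p^[t+s]-bound β t zero    _  = ≤-reflexive (cong (p ^_) (+-identityʳ t))
  p^[t+s]-bound β t (suc s) le = begin
    p ^ (t + suc s)                     ≡⟨ cong (p ^_) (+-suc t s) ⟩
    p * p ^ (t + s)                     ≡⟨ cong (_* p ^ (t + s)) (m+[n∸m]≡n (<⇒≤ 1<p)) ⟨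
    p ^ (t + s) + (p ∸ 1) * p ^ (t + s) ≤⟨ +-mono-≤ (p^[t+s]-bound β t s (<⇒≤ lt))
                                                   (*-monoʳ-≤ (p ∸ 1) (^-monoʳ-≤ p (≤-pred lt))) ⟩
    s * φ + p ^ t + (p ∸ 1) * p ^ β     ≡⟨ rearrange s (p ^ β) (p ∸ 1) (p ^ t) ⟩
    suc s * φ + p ^ t                   ∎
    where
    open ≤-Reasoning
    φ = p ^ β * (p ∸ 1)
    lt : t + s < suc β
    lt = subst (_≤ suc β) (+-suc t s) le
    rearrange : ∀ s q r x → s * (q * r) + x + r * q ≡ suc s * (q * r) + x
    rearrange = solve-∀

  -- Take s = α - t with t = ord_p(k+1), where α = β + 1. Absorption gives the divisibility, and p^t
  -- ≤ k + 1 turns `p^[t+s]-bound` into the inequality: the `s` factors p make up for the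
  -- differences by which k + 1 falls short of p^α.
  C[p^]-∣ : ∀ β k → suc k < p ^ suc β →
            ∃[ s ] (p ^ s ∣ (p ^ suc β C suc k) × p ^ suc β ≤ s * (p ^ β * (p ∸ 1)) + suc k)
  C[p^]-∣ β k 1+k<M with p-part (suc k)
  ... | t , u , 1+k≡ , p∤u = suc β ∸ t , divs , (begin
      p ^ suc β                                  ≡⟨ cong (p ^_) (m+[n∸m]≡n t≤) ⟨
      p ^ (t + (suc β ∸ t))                      ≤⟨ p^[t+s]-bound β t (suc β ∸ t) (≤-reflexive (m+[n∸m]≡n t≤)) ⟩
      (suc β ∸ t) * (p ^ β * (p ∸ 1)) + p ^ t    ≤⟨ +-monoʳ-≤ _ p^t≤ ⟩
      (suc β ∸ t) * (p ^ β * (p ∸ 1)) + suc k    ∎)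
    where
    open ≤-Reasoning
    p^t≤ : p ^ t ≤ suc k
    p^t≤ = ∣⇒≤ (subst (p ^ t ∣_) (sym 1+k≡) (m∣m*n u))
    t≤ : t ≤ suc β
    t≤ = ≮⇒≥ λ lt → <⇒≱ 1+k<M (≤-trans (^-monoʳ-≤ p (<⇒≤ lt)) p^t≤)
    absorbed : ∀ M → suc k * (M C suc k) ≡ M * (pred M C k)
    absorbed zero    = *-zeroʳ (suc k)
    absorbed (suc m) = absorption m k
    divs : p ^ (suc β ∸ t) ∣ (p ^ suc β C suc k)
    divs = ^∣-cancel-unit (suc β ∸ t) p∤u (^∣-cancel-^ (suc β) t (divides (pred (p ^ suc β) C k)
      (trans (sym (*-assoc (p ^ t) u _)) (trans (cong (_* (p ^ suc β C suc k)) (sym 1+k≡))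
        (trans (absorbed (p ^ suc β)) (*-comm (p ^ suc β) _))))))

  pow : ℕ → ℤ
  pow e = + (p ^ e)

  pow-+ : ∀ a b → pow (a + b) ≡ pow a ℤ.* pow b
  pow-+ a b = trans (cong +_ (^-distribˡ-+-* p a b)) (ℤ.pos-* (p ^ a) (p ^ b))

  pow-∣-≤ : ∀ {a b x} → a ≤ b → pow b ℤS.∣ x → pow a ℤS.∣ x
  pow-∣-≤ {a} {b} a≤b = ℤS.∣-trans (ℤS.∣ᵤ⇒∣ {pow a} {pow b} (^-monoʳ-∣ a≤b))

  pow0-∣ : ∀ x → pow 0 ℤS.∣ x
  pow0-∣ x = ℤS.divides x (sym (ℤ.*-identityʳ x))

  pow-∣-* : ∀ a b {x y} → pow a ℤS.∣ x → pow b ℤS.∣ y → pow (a + b) ℤS.∣ x ℤ.* y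
  pow-∣-* a b d d′ = subst (ℤS._∣ _) (sym (pow-+ a b)) (*-pres-∣ᶻ d d′)

  pow-∣-*-∸ : ∀ {i} s {x y} → pow s ℤS.∣ x → pow (i ∸ s) ℤS.∣ y → pow i ℤS.∣ x ℤ.* y
  pow-∣-*-∸ {i} s d d′ = pow-∣-≤ (m≤n+m∸n i s) (pow-∣-* s (i ∸ s) d d′)

  pow-cancel-∣ : ∀ a b {x} → pow (a + b) ℤS.∣ pow a ℤ.* x → pow b ℤS.∣ x
  pow-cancel-∣ a b d = ℤS.*-cancelˡ-∣ (pow a) {{m^n≢0 p a}} (subst (ℤS._∣ _) (pow-+ a b) d)

  -- Valuations of finite differences

  module _ (β : ℕ) where

    -- `β` stands for α - 1, so `M` is p^α and `φ` is its Euler totient.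
    M φ : ℕ
    M = p ^ suc β
    φ = p ^ β * (p ∸ 1)

    M≡φ+p^β : M ≡ φ + p ^ β
    M≡φ+p^β = begin
      p * p ^ β                   ≡⟨ cong (_* p ^ β) (m∸n+n≡m (<⇒≤ 1<p)) ⟨
      (p ∸ 1 + 1) * p ^ β         ≡⟨ rearrange (p ∸ 1) (p ^ β) ⟩
      φ + p ^ β                   ∎
      where
      open ≡-Reasoning
      rearrange : ∀ a b → (a + 1) * b ≡ b * a + b
      rearrange = solve-∀

    p^β≤φ : p ^ β ≤ φ
    p^β≤φ = m≤m*n (p ^ β) (p ∸ 1) {{>-nonZero (m<n⇒0<n∸m 1<p)}}

    instance
      φ≢0 : NonZero φ
      φ≢0 = >-nonZero (<-≤-trans (m^n>0 p β) p^β≤φ)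

    -- The bound ord_p(Δ^k f) ≥ ⌊(k - B)/φ⌋, phrased without division or subtraction.
    Decay : ℕ → (ℕ → ℤ) → Set
    Decay B f = ∀ i k x → i * φ + B ≤ k → pow i ℤS.∣ Δ k f x

    -- The exchange rate: giving up `s` factors p lowers the required order of differences by s φ.
    ∸φ-bound : ∀ i s {B k} → s ≤ i → i * φ + B ≤ k + s * φ → (i ∸ s) * φ + B ≤ k
    ∸φ-bound i s {B} {k} s≤i le = +-cancelʳ-≤ (s * φ) _ _ (begin
      (i ∸ s) * φ + B + s * φ   ≡⟨ rearrange (i ∸ s) φ B s ⟩
      (i ∸ s + s) * φ + B       ≡⟨ cong (λ t → t * φ + B) (m∸n+n≡m s≤i) ⟩
      i * φ + B                 ≤⟨ le ⟩
      k + s * φ                 ∎)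
      where
      open ≤-Reasoning
      rearrange : ∀ t φ B s → t * φ + B + s * φ ≡ (t + s) * φ + B
      rearrange = solve-∀

    -- Newton's formula for the shift by `M`, solved for its top term; the remaining sum runs over
    -- the indices strictly between 0 and `M`.
    Δ-M+ : ∀ k f x → Δ (M + k) f x ≡ Δ k f (x + M) ℤ.- Δ k f x
                       ℤ.- sumBelow (pred M) (λ j → + (M C suc j) ℤ.* Δ (suc j + k) f x)
    Δ-M+ k f x = begin
      Δ (M + k) f x
        ≡⟨ isolate (Δ k f x) s (Δ (M + k) f x) ⟩
      1ℤ ℤ.* Δ k f x ℤ.+ s ℤ.+ 1ℤ ℤ.* Δ (M + k) f x ℤ.- Δ k f x ℤ.- s
        ≡⟨ cong (λ t → t ℤ.- Δ k f x ℤ.- s) expand ⟨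
      Δ k f (x + M) ℤ.- Δ k f x ℤ.- s ∎
      where
      open ≡-Reasoning
      instance
        M≢0 : NonZero M
        M≢0 = m^n≢0 p (suc β)
      s = sumBelow (pred M) (λ j → + (M C suc j) ℤ.* Δ (suc j + k) f x)
      isolate : ∀ a s b → b ≡ 1ℤ ℤ.* a ℤ.+ s ℤ.+ 1ℤ ℤ.* b ℤ.- a ℤ.- s
      isolate = solve-∀ᶻ
      expand : Δ k f (x + M) ≡ 1ℤ ℤ.* Δ k f x ℤ.+ s ℤ.+ 1ℤ ℤ.* Δ (M + k) f x
      expand = begin
        Δ k f (x + M)
          ≡⟨ newton M (Δ k f) x ⟩
        sumBelow M (λ j → + (M C j) ℤ.* Δ j (Δ k f) x) ℤ.+ + (M C M) ℤ.* Δ M (Δ k f) x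
          ≡⟨ cong₂ ℤ._+_
               (sumBelow-cong M (λ {j} _ → cong (λ t → + (M C j) ℤ.* t) (Δ-Δ j k f x)))
               (cong₂ (λ c t → + c ℤ.* t) (nCn≡1 M) (Δ-Δ M k f x)) ⟩
        sumBelow M (λ j → + (M C j) ℤ.* Δ (j + k) f x) ℤ.+ 1ℤ ℤ.* Δ (M + k) f x
          ≡⟨ cong (λ t → t ℤ.+ 1ℤ ℤ.* Δ (M + k) f x) (begin
               sumBelow M (λ j → + (M C j) ℤ.* Δ (j + k) f x)
                 ≡⟨ cong (λ m → sumBelow m (λ j → + (M C j) ℤ.* Δ (j + k) f x)) (suc-pred M) ⟨
               sumBelow (suc (pred M)) (λ j → + (M C j) ℤ.* Δ (j + k) f x)
                 ≡⟨ sumBelow-suc (pred M) _ ⟩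
               1ℤ ℤ.* Δ k f x ℤ.+ s ∎) ⟩
        1ℤ ℤ.* Δ k f x ℤ.+ s ℤ.+ 1ℤ ℤ.* Δ (M + k) f x ∎

    -- For binomial coefficients Pascal's rule gives b = 0; for a^k one takes b = a^M - 1 and g = 0.
    decay-step : ∀ {B f g b} → p ^ β ≤ B → pow 2 ℤS.∣ b →
                 (∀ x → f (x + M) ≡ f x ℤ.+ b ℤ.* f x ℤ.+ g x) →
                 (∀ i k x → i * φ + B ≤ k + M → pow i ℤS.∣ Δ k g x) →
                 Decay B f
    decay-step {B} {f} {g} {b} p^β≤B p²∣b f-shift g-decay i k = <-rec
      (λ k → ∀ i x → i * φ + B ≤ k → pow i ℤS.∣ Δ k f x) step k i
      where
      step : ∀ k → (∀ {k′} → k′ < k → ∀ i x → i * φ + B ≤ k′ → pow i ℤS.∣ Δ k′ f x) →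
             ∀ i x → i * φ + B ≤ k → pow i ℤS.∣ Δ k f x
      step k rec zero        x le = pow0-∣ _
      -- With k = M + k′, three contributions remain. The factor p^2 of `b` pays for the M ≤ 2φ lost
      -- differences, `g` is covered by hypothesis, and `C[p^]-∣` pays for the intermediate terms.
      step k rec i@(suc i-1) x le = subst (λ k → pow i ℤS.∣ Δ k f x) M+k′≡k
        (subst (pow i ℤS.∣_) (sym recurrence)
          (ℤS.∣m∣n⇒∣m-n
            (ℤS.∣m∣n⇒∣m+n
              (term 2 p²∣b k′<k (≤-trans le (≤-trans (≤-reflexive k≡) (+-monoʳ-≤ k′ M≤2φ))))
              (g-decay i k′ x (subst (i * φ + B ≤_) k≡ le)))
            (∣-sumBelow (pred M) inner)))
        where
        M≤k : M ≤ k
        M≤k = begin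
          M                        ≡⟨ M≡φ+p^β ⟩
          φ + p ^ β                ≤⟨ +-mono-≤ (m≤m+n φ (i-1 * φ)) p^β≤B ⟩
          i * φ + B                ≤⟨ le ⟩
          k                        ∎
          where open ≤-Reasoning
        k′ = k ∸ M
        M+k′≡k : M + k′ ≡ k
        M+k′≡k = m+[n∸m]≡n M≤k
        k≡ : k ≡ k′ + M
        k≡ = sym (m∸n+n≡m M≤k)
        k′<k : k′ < k
        k′<k = subst (k′ <_) M+k′≡k (m<n+m k′ (m^n>0 p (suc β)))
        M≤2φ : M ≤ 2 * φ
        M≤2φ = ≤-trans (≤-reflexive M≡φ+p^β) (+-monoʳ-≤ φ (≤-trans p^β≤φ (m≤m+n φ 0)))

        -- If s > i the coefficient alone is divisible by p^i; otherwise only i - s factors are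
        -- asked of the difference.
        term : ∀ s {c k″} → pow s ℤS.∣ c → k″ < k → i * φ + B ≤ k″ + s * φ → pow i ℤS.∣ c ℤ.* Δ k″ f x
        term s {c} {k″} d k″<k bound with s ℕ.≤? i
        ... | yes s≤i = pow-∣-*-∸ s d (rec k″<k (i ∸ s) x (∸φ-bound i s s≤i bound))
        ... | no  s≰i = ℤS.∣m⇒∣m*n _ (pow-∣-≤ (<⇒≤ (≰⇒> s≰i)) d)

        inner : ∀ {j} → j < pred M → pow i ℤS.∣ + (M C suc j) ℤ.* Δ (suc j + k′) f x
        inner {j} j<M-1 with C[p^]-∣ β j (pred-cancel-< j<M-1)
        ... | s , d , M≤ = term s (ℤS.∣ᵤ⇒∣ {pow s} {+ (M C suc j)} d)
              (subst (suc j + k′ <_) M+k′≡k (+-monoˡ-< k′ (pred-cancel-< j<M-1)))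
              (begin
                i * φ + B              ≤⟨ le ⟩
                k                      ≡⟨ k≡ ⟩
                k′ + M                 ≤⟨ +-monoʳ-≤ k′ M≤ ⟩
                k′ + (s * φ + suc j)   ≡⟨ rearrange k′ (s * φ) (suc j) ⟩
                suc j + k′ + s * φ     ∎)
          where
          open ≤-Reasoning
          rearrange : ∀ a b c → a + (b + c) ≡ c + a + b
          rearrange = solve-∀

        recurrence : Δ (M + k′) f x ≡ b ℤ.* Δ k′ f x ℤ.+ Δ k′ g x
                       ℤ.- sumBelow (pred M) (λ j → + (M C suc j) ℤ.* Δ (suc j + k′) f x)
        recurrence = trans (Δ-M+ k′ f x) (cong (λ t → t ℤ.- sumBelow (pred M) (λ j → + (M C suc j) ℤ.* Δ (suc j + k′) f x)) (begin
          Δ k′ f (x + M) ℤ.- Δ k′ f x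
            ≡⟨ cong (ℤ._- Δ k′ f x) (trans (sym (Δ-shift k′ f M x)) (Δ-cong k′ f-shift x)) ⟩
          Δ k′ (λ y → f y ℤ.+ b ℤ.* f y ℤ.+ g y) x ℤ.- Δ k′ f x
            ≡⟨ cong (ℤ._- Δ k′ f x) (trans (Δ-+ k′ _ g x)
                 (cong (ℤ._+ Δ k′ g x) (trans (Δ-+ k′ f _ x) (cong (λ t → Δ k′ f x ℤ.+ t) (Δ-* k′ b f x))))) ⟩
          Δ k′ f x ℤ.+ b ℤ.* Δ k′ f x ℤ.+ Δ k′ g x ℤ.- Δ k′ f x
            ≡⟨ cancel (Δ k′ f x) (b ℤ.* Δ k′ f x) (Δ k′ g x) ⟩
          b ℤ.* Δ k′ f x ℤ.+ Δ k′ g x ∎))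
          where
          open ≡-Reasoning
          cancel : ∀ a c d → a ℤ.+ c ℤ.+ d ℤ.- a ≡ c ℤ.+ d
          cancel = solve-∀ᶻ

    -- Valuations of surjection numbers and the combined bound

    ⌊0/p^⌋≡0 : ∀ β → ⌊ 0 /p^ β ⌋ ≡ 0
    ⌊0/p^⌋≡0 zero    = refl
    ⌊0/p^⌋≡0 (suc β) = trans (/-congˡ (⌊0/p^⌋≡0 β)) (0/n≡0 p)

    ⌊_⌋ : ℕ → ℕ
    ⌊ n ⌋ = ⌊ n /p^ β ⌋

    -- The bound ord_p(surj n j) ≥ e - s for s ≥ ⌊(n-j)/φ⌋. In the summand C(n,i) surj i (j-1) let
    -- e₂ be the valuation of ⌊(n-i)/p^β⌋!. Legendre gives e₂ φ < n - i, so s - e₂ suffices for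
    -- `surj i (j-1)`, while C(n,i) and the two factorials together account for `e`.
    surj-∣ : ∀ j n s e → p ^ e ∣ ⌊ n ⌋ ! → n < j + suc s * φ → pow e ℤS.∣ pow s ℤ.* surj n j
    surj-∣ zero    zero    s e d _ = ℤS.∣-trans
      (ℤS.∣ᵤ⇒∣ {pow e} {1ℤ} (subst (λ m → p ^ e ∣ m !) (⌊0/p^⌋≡0 β) d)) (pow0-∣ _)
    surj-∣ zero    (suc n) s e d _ =
      subst (pow e ℤS.∣_) (sym (trans (cong (λ t → pow s ℤ.* t) (surj-zero n)) (ℤ.*-zeroʳ (pow s)))) (ℤS.divides 0ℤ refl)
    surj-∣ (suc j) n       s e d n< = subst (pow e ℤS.∣_) (sym (cong (λ t → pow s ℤ.* t) (surj-binomial n j)))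
      (subst (pow e ℤS.∣_) (sumBelow-*ˡ n (pow s) _) (∣-sumBelow n term))
      where
      sumBelow-*ˡ : ∀ n c f → sumBelow n (λ k → c ℤ.* f k) ≡ c ℤ.* sumBelow n f
      sumBelow-*ˡ zero    c f = sym (ℤ.*-zeroʳ c)
      sumBelow-*ˡ (suc n) c f =
        trans (cong (ℤ._+ c ℤ.* f n) (sumBelow-*ˡ n c f)) (sym (ℤ.*-distribˡ-+ c (sumBelow n f) (f n)))

      term : ∀ {i} → i < n → pow e ℤS.∣ pow s ℤ.* (+ (n C i) ℤ.* surj i j)
      term {i} i<n with p-part (⌊ i ⌋ !) {{⌊ i ⌋ !≢0}} | p-part (⌊ n ∸ i ⌋ !) {{⌊ n ∸ i ⌋ !≢0}}
      ... | e₁ , u₁ , ⌊i⌋!≡ , p∤u₁ | e₂ , u₂ , ⌊m⌋!≡ , p∤u₂ with e₂ ℕ.≤? s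
      ...   | yes e₂≤s = subst (pow e ℤS.∣_) (rearrange (+ (n C i)) (pow s) (surj i j))
                (ℤS.∣-trans (ℤS.∣ᵤ⇒∣ {pow e} {+ ((n C i) * (p ^ e₁ * p ^ e₂))} e∣)
                  (ℤS.∣-trans (ℤS.∣-reflexive (ℤ.pos-* (n C i) _)) (ℤS.*-monoʳ-∣ (+ (n C i)) e₁e₂∣)))
        where
        m = n ∸ i
        i+m≡n : i + m ≡ n
        i+m≡n = m+[n∸m]≡n (<⇒≤ i<n)
        e∣ : p ^ e ∣ (n C i) * (p ^ e₁ * p ^ e₂)
        e∣ = ^∣-cancel-unit e (p∤* p∤u₁ p∤u₂) (subst (p ^ e ∣_) (begin
          ((i + m) C i) * (⌊ i ⌋ ! * ⌊ m ⌋ !)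
            ≡⟨ cong₂ (λ c t → (c C i) * t) i+m≡n (cong₂ _*_ ⌊i⌋!≡ ⌊m⌋!≡) ⟩
          (n C i) * (p ^ e₁ * u₁ * (p ^ e₂ * u₂))
            ≡⟨ swap (n C i) (p ^ e₁) u₁ (p ^ e₂) u₂ ⟩
          u₁ * u₂ * ((n C i) * (p ^ e₁ * p ^ e₂)) ∎)
          (C*⌊/p^⌋!-∣ β i m e (subst (λ n → p ^ e ∣ ⌊ n ⌋ !) (sym i+m≡n) d)))
          where
          open ≡-Reasoning
          swap : ∀ c a u b v → c * (a * u * (b * v)) ≡ u * v * (c * (a * b))
          swap = solve-∀
        i< : i < j + suc (s ∸ e₂) * φ
        -- The strictness in Legendre's bound supplies the 1 lost in passing from `suc j` to `j`.
        i< = +-cancelʳ-< (suc (e₂ * φ)) _ _ (begin-strict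
          i + suc (e₂ * φ)                         ≤⟨ +-monoʳ-≤ i (legendre-bound-⌊/p^⌋ β m e₂ (m<n⇒0<n∸m i<n)
                                                       (subst (p ^ e₂ ∣_) (sym ⌊m⌋!≡) (m∣m*n u₂))) ⟩
          i + m                                    ≡⟨ i+m≡n ⟩
          n                                        <⟨ n< ⟩
          suc j + suc s * φ                        ≡⟨ cong (λ t → suc j + suc t * φ) (m∸n+n≡m e₂≤s) ⟨
          suc j + suc (s ∸ e₂ + e₂) * φ            ≡⟨ swap j (s ∸ e₂) e₂ φ ⟩
          j + suc (s ∸ e₂) * φ + suc (e₂ * φ)      ∎)
          where
          open ≤-Reasoning
          swap : ∀ j t e φ → suc j + suc (t + e) * φ ≡ j + suc t * φ + suc (e * φ)
          swap = solve-∀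
        e₁e₂∣ : + (p ^ e₁ * p ^ e₂) ℤS.∣ pow s ℤ.* surj i j
        e₁e₂∣ = subst₂ ℤS._∣_ (sym (ℤ.pos-* (p ^ e₁) (p ^ e₂)))
          (trans (shuffle (pow (s ∸ e₂)) (surj i j) (pow e₂))
            (cong (ℤ._* surj i j) (trans (sym (pow-+ (s ∸ e₂) e₂)) (cong pow (m∸n+n≡m e₂≤s)))))
          (*-pres-∣ᶻ {b = pow e₂} (surj-∣ j i (s ∸ e₂) e₁ (subst (p ^ e₁ ∣_) (sym ⌊i⌋!≡) (m∣m*n u₁)) i<) ℤS.∣-refl)
          where
          shuffle : ∀ a w b → a ℤ.* w ℤ.* b ≡ a ℤ.* b ℤ.* w
          shuffle = solve-∀ᶻ
        rearrange : ∀ c s w → c ℤ.* (s ℤ.* w) ≡ s ℤ.* (c ℤ.* w)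
        rearrange = solve-∀ᶻ
      -- If e₂ > s, then n - i exceeds (s + 1) φ, which forces i < j, and the summand is zero.
      ...   | no e₂≰s = subst (pow e ℤS.∣_)
                (sym (trans (cong (λ t → pow s ℤ.* (+ (n C i) ℤ.* t)) (n<j⇒surj≡0 i<j)) (vanish (pow s) (+ (n C i)))))
                (ℤS.divides 0ℤ refl)
        where
        vanish : ∀ a b → a ℤ.* (b ℤ.* 0ℤ) ≡ 0ℤ
        vanish = solve-∀ᶻ
        m = n ∸ i
        i<j : i < j
        i<j = +-cancelʳ-< (suc (suc s * φ)) _ _ (begin-strict
          i + suc (suc s * φ)    ≤⟨ +-monoʳ-≤ i (≤-trans (s≤s (*-monoˡ-≤ φ (≰⇒> e₂≰s)))
                                      (legendre-bound-⌊/p^⌋ β m e₂ (m<n⇒0<n∸m i<n)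
                                        (subst (p ^ e₂ ∣_) (sym ⌊m⌋!≡) (m∣m*n u₂)))) ⟩
          i + m                  ≡⟨ m+[n∸m]≡n (<⇒≤ i<n) ⟩
          n                      <⟨ n< ⟩
          suc j + suc s * φ      ≡⟨ +-suc j (suc s * φ) ⟨
          j + suc (suc s * φ)    ∎)
          where open ≤-Reasoning

    -- With s = ⌊(n-j)/φ⌋, the surjection number contributes e - s factors p and the difference s -
    -- c, so `s` cancels and every summand has at least e - c.
    ascentSum-∣ : ∀ {B f} n e c → Decay B f → p ^ e ∣ ⌊ n ⌋ ! → B ≤ c * φ →
                  ∀ i → i + c ≤ e → pow i ℤS.∣ ascentSum n f
    ascentSum-∣ {B} {f} n e c decay d B≤ i i+c≤e =
      subst (pow i ℤS.∣_) (sym (ascentSum-Δ n f)) (∣-sumBelow (suc n) (λ {j} j<1+n → term j (≤-pred j<1+n)))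
      where
      term : ∀ j → j ≤ n → pow i ℤS.∣ surj n j ℤ.* Δ (n ∸ j) f 0
      -- To avoid negative exponents, p^(e+s) is shown to divide p^s p^c times the summand; p^s and
      -- p^c are then cancelled.
      term j j≤n = pow-cancel-∣ c i (pow-∣-≤ (subst (_≤ e) (+-comm i c) i+c≤e) (pow-cancel-∣ s e
        (subst₂ ℤS._∣_ (cong pow (+-comm e s)) (shuffle (pow s) w (pow c) (Δ k f 0)) (pow-∣-* e s s∣w c∣Δ))))
        where
        k = n ∸ j
        s = k / φ
        w = surj n j
        shuffle : ∀ s w c x → s ℤ.* w ℤ.* (c ℤ.* x) ≡ s ℤ.* (c ℤ.* (w ℤ.* x))
        shuffle = solve-∀ᶻ
        sφ≤k : s * φ ≤ k
        sφ≤k = m/n*n≤m k φ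
        s∣w : pow e ℤS.∣ pow s ℤ.* w
        s∣w = surj-∣ j n s e d (begin-strict
          n                    ≡⟨ m+[n∸m]≡n j≤n ⟨
          j + k                <⟨ +-monoʳ-< j (begin-strict
            k                     ≡⟨ m≡m%n+[m/n]*n k φ ⟩
            k % φ + s * φ         <⟨ +-monoˡ-< (s * φ) (m%n<n k φ) ⟩
            suc s * φ             ∎) ⟩
          j + suc s * φ        ∎)
          where open ≤-Reasoning
        c∣Δ : pow s ℤS.∣ pow c ℤ.* Δ k f 0
        c∣Δ with c ℕ.≤? s
        ... | yes c≤s = pow-∣-*-∸ c ℤS.∣-refl (decay (s ∸ c) k 0 (∸φ-bound s c c≤s (+-mono-≤ sφ≤k B≤)))
        ... | no  c≰s = ℤS.∣m⇒∣m*n (Δ k f 0) (pow-∣-≤ (<⇒≤ (≰⇒> c≰s)) ℤS.∣-refl)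

-- Functions supported on a residue class

/ℕ-exact : ∀ q m .{{_ : NonZero m}} → (q ℤ.* + m) ℤ./ℕ m ≡ q
/ℕ-exact q m = sym (ℤ.*-cancelʳ-≡ q Q (+ m) {{ℕ≢0}} (trans (ℤ.a≡a%ℕn+[a/ℕn]*n x m) (trans
  (cong (λ r → + r ℤ.+ Q ℤ.* + m) r≡0) (ℤ.+-identityˡ _))))
  where
  x = q ℤ.* + m
  Q = x ℤ./ℕ m
  r = x ℤ.%ℕ m
  ℕ≢0 : ℤ.NonZero (+ m)
  ℕ≢0 = ℤ.≢-nonZero λ eq → ℕ.≢-nonZero⁻¹ m (ℤ.+-injective eq)
  m∣r : m ∣ r
  m∣r = ℤS.∣⇒∣ᵤ {+ m} {+ r} (ℤS.∣m+n∣n⇒∣m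
    (subst (+ m ℤS.∣_) (ℤ.a≡a%ℕn+[a/ℕn]*n x m) (ℤS.divides q refl)) (ℤS.divides Q refl))
  r≡0 : r ≡ 0
  r≡0 with r in eq
  ... | zero  = refl
  ... | suc _ = contradiction (ℤ.n%ℕd<d x m) (≤⇒≯ (subst (m ≤_) (sym eq) (∣⇒≤ (subst (m ∣_) eq m∣r))))

quotℤ-exact : ∀ q m → NonZero m → quotℤ (q ℤ.* + m) m ≡ q
quotℤ-exact q (suc m) _ = /ℕ-exact q (suc m)

-- The definition appends the last factor of the product; here the first one is split off.
fallingℤ-1+ : ∀ x l → fallingℤ (1ℤ ℤ.+ x) (suc l) ≡ (1ℤ ℤ.+ x) ℤ.* fallingℤ x l
fallingℤ-1+ x zero    = base x
  where
  base : ∀ x → 1ℤ ℤ.* (1ℤ ℤ.+ x ℤ.- 0ℤ) ≡ (1ℤ ℤ.+ x) ℤ.* 1ℤ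
  base = solve-∀ᶻ
fallingℤ-1+ x (suc l) = trans (cong (ℤ._* (1ℤ ℤ.+ x ℤ.- + suc l)) (fallingℤ-1+ x l))
  (step x (+ l) (fallingℤ x l))
  where
  step : ∀ x l f → (1ℤ ℤ.+ x) ℤ.* f ℤ.* (1ℤ ℤ.+ x ℤ.- (1ℤ ℤ.+ l)) ≡ (1ℤ ℤ.+ x) ℤ.* (f ℤ.* (x ℤ.- l))
  step = solve-∀ᶻ

fallingℤ-pascal : ∀ x l → fallingℤ (1ℤ ℤ.+ x) (suc l) ≡ fallingℤ x (suc l) ℤ.+ fallingℤ x l ℤ.* + suc l
fallingℤ-pascal x l = trans (fallingℤ-1+ x l) (split x (+ l) (fallingℤ x l))
  where
  split : ∀ x l f → (1ℤ ℤ.+ x) ℤ.* f ≡ f ℤ.* (x ℤ.- l) ℤ.+ f ℤ.* (1ℤ ℤ.+ l)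
  split = solve-∀ᶻ

ℤ-induction : (P : ℤ → Set) → P 0ℤ → (∀ x → P x → P (1ℤ ℤ.+ x)) → (∀ x → P (1ℤ ℤ.+ x) → P x) → ∀ x → P x
ℤ-induction P p0 up down (+ zero)         = p0
ℤ-induction P p0 up down (+ suc n)        = up (+ n) (ℤ-induction P p0 up down (+ n))
ℤ-induction P p0 up down ℤ.-[1+ zero ]    = down ℤ.-[1+ zero ] p0
ℤ-induction P p0 up down ℤ.-[1+ suc n ]   = down ℤ.-[1+ suc n ] (ℤ-induction P p0 up down ℤ.-[1+ n ])

-- By `fallingℤ-pascal` and the case of `l`, the values at x and 1 + x agree modulo (l+1)!, so
-- divisibility spreads from x = 0 in both directions.
!∣fallingℤ : ∀ l x → + (l !) ℤS.∣ fallingℤ x l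
!∣fallingℤ zero    x = ℤS.∣-refl
!∣fallingℤ (suc l) = ℤ-induction (λ x → + (suc l !) ℤS.∣ fallingℤ x (suc l))
  -- Reading 0 as 1 + (-1) exhibits the vanishing first factor.
  (subst (+ (suc l !) ℤS.∣_) (sym (trans (fallingℤ-1+ -1ℤ l) (ℤ.*-zeroˡ (fallingℤ -1ℤ l)))) (ℤS.divides 0ℤ refl))
  (λ x d → subst (+ (suc l !) ℤS.∣_) (sym (fallingℤ-pascal x l)) (ℤS.∣m∣n⇒∣m+n d (lower x)))
  (λ x d → ℤS.∣m+n∣n⇒∣m (subst (+ (suc l !) ℤS.∣_) (fallingℤ-pascal x l) d) (lower x))
  where
  lower : ∀ x → + (suc l !) ℤS.∣ fallingℤ x l ℤ.* + suc l
  lower x = subst (ℤS._∣ fallingℤ x l ℤ.* + suc l)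
    (trans (sym (ℤ.pos-* (l !) (suc l))) (cong +_ (*-comm (l !) (suc l))))
    (ℤS.*-monoˡ-∣ (+ suc l) {+ (l !)} (!∣fallingℤ l x))

-- The rounding division in `binomℤ` is exact.
fallingℤ≡binomℤ*! : ∀ x l → fallingℤ x l ≡ binomℤ x l ℤ.* + (l !)
fallingℤ≡binomℤ*! x l with !∣fallingℤ l x
... | ℤS.divides q eq = trans eq (cong (ℤ._* + (l !))
  (sym (trans (cong (λ y → (y ℤ./ℕ (l !)) {{l !≢0}}) eq) (/ℕ-exact q (l !) {{l !≢0}}))))

binomℤ-pascal : ∀ x l → binomℤ (1ℤ ℤ.+ x) (suc l) ≡ binomℤ x (suc l) ℤ.+ binomℤ x l
binomℤ-pascal x l = ℤ.*-cancelʳ-≡ _ _ (+ (suc l !)) {{suc l !≢0}} (begin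
  binomℤ (1ℤ ℤ.+ x) (suc l) ℤ.* + (suc l !)
    ≡⟨ fallingℤ≡binomℤ*! (1ℤ ℤ.+ x) (suc l) ⟨
  fallingℤ (1ℤ ℤ.+ x) (suc l)
    ≡⟨ fallingℤ-pascal x l ⟩
  fallingℤ x (suc l) ℤ.+ fallingℤ x l ℤ.* + suc l
    ≡⟨ cong₂ (λ a b → a ℤ.+ b ℤ.* + suc l) (fallingℤ≡binomℤ*! x (suc l)) (fallingℤ≡binomℤ*! x l) ⟩
  binomℤ x (suc l) ℤ.* + (suc l !) ℤ.+ binomℤ x l ℤ.* + (l !) ℤ.* + suc l
    ≡⟨ cong (λ t → binomℤ x (suc l) ℤ.* + (suc l !) ℤ.+ t) (trans (ℤ.*-assoc (binomℤ x l) (+ (l !)) (+ suc l))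
         (cong (λ t → binomℤ x l ℤ.* t) (trans (sym (ℤ.pos-* (l !) (suc l))) (cong +_ (*-comm (l !) (suc l)))))) ⟩
  binomℤ x (suc l) ℤ.* + (suc l !) ℤ.+ binomℤ x l ℤ.* + (suc l !)
    ≡⟨ ℤ.*-distribʳ-+ (+ (suc l !)) (binomℤ x (suc l)) (binomℤ x l) ⟨
  (binomℤ x (suc l) ℤ.+ binomℤ x l) ℤ.* + (suc l !) ∎)
  where open ≡-Reasoning

-- Moves the congruence test of `residueSum` into the function paired with the Eulerian row.
onResidue : ℕ → ℤ → (ℤ → ℕ → ℤ) → ℕ → ℤ
onResidue M r g k = if does (M ∣? ℤ.∣ + k ℤ.- r ∣) then g (quotℤ (+ k ℤ.- r) M) k else 0ℤ

residueSum≡ascentSum : ∀ n → 0 < n → ∀ r M g → residueSum n r M g ≡ ascentSum n (onResidue M r g)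
residueSum≡ascentSum n 0<n r M g = trans
  (sumBelow-cong n (λ {k} _ → push (does (M ∣? ℤ.∣ + k ℤ.- r ∣)) (+ eulerian n k) _))
  (sumBelow-eulerian n 0<n (onResidue M r g))
  where
  push : ∀ b c x → (if b then c ℤ.* x else 0ℤ) ≡ c ℤ.* (if b then x else 0ℤ)
  push true  c x = refl
  push false c x = sym (ℤ.*-zeroʳ c)

-- A shift by `M` keeps the residue class and raises the quotient by one, so a recurrence of `g` in
-- the quotient becomes a difference equation with step `M`.
onResidue-shift : ∀ M → NonZero M → ∀ r g g′ →
                  (∀ q k → g (1ℤ ℤ.+ q) (k + M) ≡ g′ q k) →
                  ∀ k → onResidue M r g (k + M) ≡ onResidue M r g′ k
onResidue-shift M M≢0 r g g′ g-shift k = trans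
  (cong (λ b → if b then g (quotℤ (+ (k + M) ℤ.- r) M) (k + M) else 0ℤ)
    (does-⇔ (mk⇔ to from) (M ∣? ℤ.∣ + (k + M) ℤ.- r ∣) (M ∣? ℤ.∣ + k ℤ.- r ∣)))
  values
  where
  k+M-r : + (k + M) ℤ.- r ≡ + k ℤ.- r ℤ.+ + M
  k+M-r = swap (+ k) (+ M) r
    where
    swap : ∀ k m r → k ℤ.+ m ℤ.- r ≡ k ℤ.- r ℤ.+ m
    swap = solve-∀ᶻ
  to : M ∣ ℤ.∣ + (k + M) ℤ.- r ∣ → M ∣ ℤ.∣ + k ℤ.- r ∣
  to d = ℤS.∣⇒∣ᵤ {+ M} (ℤS.∣m+n∣n⇒∣m {m = + k ℤ.- r} (subst (+ M ℤS.∣_) k+M-r (ℤS.∣ᵤ⇒∣ d)) ℤS.∣-refl)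
  from : M ∣ ℤ.∣ + k ℤ.- r ∣ → M ∣ ℤ.∣ + (k + M) ℤ.- r ∣
  from d = ℤS.∣⇒∣ᵤ {+ M} (subst (+ M ℤS.∣_) (sym k+M-r) (ℤS.∣m∣n⇒∣m+n {m = + k ℤ.- r} (ℤS.∣ᵤ⇒∣ d) ℤS.∣-refl))
  values : (if does (M ∣? ℤ.∣ + k ℤ.- r ∣) then g (quotℤ (+ (k + M) ℤ.- r) M) (k + M) else 0ℤ) ≡
           onResidue M r g′ k
  values with M ∣? ℤ.∣ + k ℤ.- r ∣
  ... | no  _ = refl
  ... | yes d with ℤS.∣ᵤ⇒∣ {+ M} d
  ...   | ℤS.divides q eq = begin
      g (quotℤ (+ (k + M) ℤ.- r) M) (k + M)   ≡⟨ cong (λ y → g y (k + M)) quot+M ⟩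
      g (1ℤ ℤ.+ q) (k + M)                    ≡⟨ g-shift q k ⟩
      g′ q k                                  ≡⟨ cong (λ y → g′ y k) (trans (cong (λ y → quotℤ y M) eq) (quotℤ-exact q M M≢0)) ⟨
      g′ (quotℤ (+ k ℤ.- r) M) k              ∎
    where
    open ≡-Reasoning
    factor : ∀ q m → q ℤ.* m ℤ.+ m ≡ (1ℤ ℤ.+ q) ℤ.* m
    factor = solve-∀ᶻ
    quot+M : quotℤ (+ (k + M) ℤ.- r) M ≡ 1ℤ ℤ.+ q
    quot+M = trans (cong (λ y → quotℤ y M) (trans k+M-r (trans (cong (ℤ._+ + M) eq) (factor q (+ M)))))
      (quotℤ-exact (1ℤ ℤ.+ q) M M≢0)

-- The binomial theorem, cut off after the linear term.
u²∣[1+u]^ : ∀ u m → u ℤ.* u ℤS.∣ (1ℤ ℤ.+ u) ℤ.^ m ℤ.- (1ℤ ℤ.+ + m ℤ.* u)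
u²∣[1+u]^ u zero    = ℤS.divides 0ℤ (base u)
  where
  base : ∀ u → 1ℤ ℤ.- (1ℤ ℤ.+ 0ℤ ℤ.* u) ≡ 0ℤ ℤ.* (u ℤ.* u)
  base = solve-∀ᶻ
u²∣[1+u]^ u (suc m) = subst (u ℤ.* u ℤS.∣_) (step u (+ m) ((1ℤ ℤ.+ u) ℤ.^ m))
  (ℤS.∣m∣n⇒∣m+n (ℤS.∣n⇒∣m*n (1ℤ ℤ.+ u) (u²∣[1+u]^ u m)) (ℤS.∣n⇒∣m*n (+ m) ℤS.∣-refl))
  where
  step : ∀ u m w → (1ℤ ℤ.+ u) ℤ.* (w ℤ.- (1ℤ ℤ.+ m ℤ.* u)) ℤ.+ m ℤ.* (u ℤ.* u) ≡
                   (1ℤ ℤ.+ u) ℤ.* w ℤ.- (1ℤ ℤ.+ (1ℤ ℤ.+ m) ℤ.* u)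
  step = solve-∀ᶻ

∣-1⇒∣^-1 : ∀ {d a} m → d ℤS.∣ a ℤ.- 1ℤ → d ℤS.∣ a ℤ.^ m ℤ.- 1ℤ
∣-1⇒∣^-1         zero    d∣ = ℤS.divides 0ℤ refl
∣-1⇒∣^-1 {d} {a} (suc m) d∣ = subst (d ℤS.∣_) (step a (a ℤ.^ m))
  (ℤS.∣m∣n⇒∣m+n (ℤS.∣n⇒∣m*n a (∣-1⇒∣^-1 m d∣)) d∣)
  where
  step : ∀ a w → a ℤ.* (w ℤ.- 1ℤ) ℤ.+ (a ℤ.- 1ℤ) ≡ a ℤ.* w ℤ.- 1ℤ
  step = solve-∀ᶻ

-- For u = a - 1, a^p is 1 + p u modulo u², and p² divides both p u and u².
∣-1⇒²∣^-1 : ∀ {p a} → + p ℤS.∣ a ℤ.- 1ℤ → + (p ^ 2) ℤS.∣ a ℤ.^ p ℤ.- 1ℤ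
∣-1⇒²∣^-1 {p} {a} d = subst₂ ℤS._∣_ p²≡
  (trans (cong (λ b → b ℤ.^ p ℤ.- (1ℤ ℤ.+ + p ℤ.* u) ℤ.+ + p ℤ.* u) (1+u a)) (collect (a ℤ.^ p) (+ p ℤ.* u)))
  (ℤS.∣m∣n⇒∣m+n (ℤS.∣-trans (*-pres-∣ᶻ d d) (u²∣[1+u]^ u p)) (*-pres-∣ᶻ (ℤS.∣-refl {+ p}) d))
  where
  u = a ℤ.- 1ℤ
  1+u : ∀ a → 1ℤ ℤ.+ (a ℤ.- 1ℤ) ≡ a
  1+u = solve-∀ᶻ
  collect : ∀ w v → w ℤ.- (1ℤ ℤ.+ v) ℤ.+ v ≡ w ℤ.- 1ℤ
  collect = solve-∀ᶻ
  p²≡ : + p ℤ.* + p ≡ + (p ^ 2)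
  p²≡ = trans (sym (ℤ.pos-* p p)) (cong +_ (cong (p *_) (sym (*-identityʳ p))))

≤-ceilDiv-* : ∀ a b → NonZero b → a ≤ ceilDiv a b * b
≤-ceilDiv-* a (suc b) _ = +-cancelʳ-≤ b a _ (begin
  a + b                                          ≡⟨ m≡m%n+[m/n]*n (a + b) (suc b) ⟩
  (a + b) % suc b + (a + b) / suc b * suc b      ≤⟨ +-monoˡ-≤ _ (≤-pred (m%n<n (a + b) (suc b))) ⟩
  b + (a + b) / suc b * suc b                    ≡⟨ +-comm b _ ⟩
  (a + b) / suc b * suc b + b                    ∎)
  where open ≤-Reasoning

floorDiv≡/ : ∀ a b .{{_ : NonZero b}} → floorDiv a b ≡ a / b
floorDiv≡/ a (suc b) = refl

-- Application to binomial coefficients and powers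

module _ {p : ℕ} (p-prime : Prime p) (β : ℕ) (r : ℤ) where

  private
    instance
      p^β≢0 : NonZero (p ^ β)
      p^β≢0 = m^n≢0 p β {{prime⇒nonZero p-prime}}

    M≢0 : NonZero (p ^ suc β)
    M≢0 = m^n≢0 p (suc β) {{prime⇒nonZero p-prime}}

  floorDiv≡⌊/p^⌋ : ∀ n → floorDiv n (p ^ β) ≡ ⌊_/p^_⌋ p-prime n β
  floorDiv≡⌊/p^⌋ n = trans (floorDiv≡/ n (p ^ β)) (sym (⌊/p^⌋≡/ p-prime n β))

  -- For l = 0 the function has period p^α. For l + 1, Pascal's rule makes the shift add the
  -- function for l, and the extra p^α in the constant is exactly the allowance `decay-step` grants
  -- `g`.
  binomial-decay : ∀ l → Decay p-prime β (p ^ β + l * p ^ suc β) (onResidue (p ^ suc β) r (λ q _ → binomℤ q l))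
  binomial-decay zero = decay-step p-prime β {g = λ _ → 0ℤ} (m≤m+n (p ^ β) 0) (ℤS.divides 0ℤ refl)
    (λ x → trans (onResidue-shift (p ^ suc β) M≢0 r (λ q _ → binomℤ q 0) (λ q _ → binomℤ q 0) (λ _ _ → refl) x)
      (pad (onResidue (p ^ suc β) r (λ q _ → binomℤ q 0) x)))
    (λ i k x _ → subst (pow p-prime i ℤS.∣_) (sym (Δ-0 k x)) (ℤS.divides 0ℤ refl))
    where
    pad : ∀ a → a ≡ a ℤ.+ 0ℤ ℤ.* a ℤ.+ 0ℤ
    pad = solve-∀ᶻ
  binomial-decay (suc l) = decay-step p-prime β (m≤m+n (p ^ β) _) (ℤS.divides 0ℤ refl)
    (λ x → trans (onResidue-shift (p ^ suc β) M≢0 r (λ q _ → binomℤ q (suc l)) (λ q _ → binomℤ q (suc l) ℤ.+ binomℤ q l)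
                   (λ q _ → binomℤ-pascal q l) x)
             (split x (does (p ^ suc β ∣? ℤ.∣ + x ℤ.- r ∣))))
    (λ i k x le → binomial-decay l i k x (+-cancelʳ-≤ (p ^ suc β) _ _
      (subst (_≤ k + p ^ suc β) (rearrange (i * φ p-prime β) (p ^ β) l (p ^ suc β)) le)))
    where
    split : ∀ x b → let q = quotℤ (+ x ℤ.- r) (p ^ suc β) in
            (if b then binomℤ q (suc l) ℤ.+ binomℤ q l else 0ℤ) ≡
            (if b then binomℤ q (suc l) else 0ℤ) ℤ.+ 0ℤ ℤ.* (if b then binomℤ q (suc l) else 0ℤ)
              ℤ.+ (if b then binomℤ q l else 0ℤ)
    split x true  = pad (binomℤ _ (suc l)) (binomℤ _ l)
      where
      pad : ∀ a b → a ℤ.+ b ≡ a ℤ.+ 0ℤ ℤ.* a ℤ.+ b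
      pad = solve-∀ᶻ
    split x false = refl
    rearrange : ∀ a b l m → a + (b + suc l * m) ≡ a + (b + l * m) + m
    rearrange = solve-∀

  -- a^p ≡ 1 mod p², hence also a^(p^α) ≡ 1 mod p², because p^α is a multiple of p.
  power-decay : ∀ a → + p ℤS.∣ a ℤ.- 1ℤ → Decay p-prime β (p ^ β) (onResidue (p ^ suc β) r (λ _ k → a ℤ.^ k))
  power-decay a d = decay-step p-prime β {g = λ _ → 0ℤ} ≤-refl p²∣
    (λ x → trans (onResidue-shift (p ^ suc β) M≢0 r (λ _ k → a ℤ.^ k) (λ _ k → a ℤ.^ (k + p ^ suc β)) (λ _ _ → refl) x)
             (split x (does (p ^ suc β ∣? ℤ.∣ + x ℤ.- r ∣))))
    (λ i k x _ → subst (pow p-prime i ℤS.∣_) (sym (Δ-0 k x)) (ℤS.divides 0ℤ refl))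
    where
    b = a ℤ.^ (p ^ suc β) ℤ.- 1ℤ
    p²∣ : + (p ^ 2) ℤS.∣ b
    p²∣ = subst (λ w → + (p ^ 2) ℤS.∣ w ℤ.- 1ℤ) (ℤ.^-*-assoc a p (p ^ β))
            (∣-1⇒∣^-1 (p ^ β) (∣-1⇒²∣^-1 d))
    split : ∀ x c → (if c then a ℤ.^ (x + p ^ suc β) else 0ℤ) ≡
                    (if c then a ℤ.^ x else 0ℤ) ℤ.+ b ℤ.* (if c then a ℤ.^ x else 0ℤ) ℤ.+ 0ℤ
    split x true  = trans (ℤ.^-distribˡ-+-* a x (p ^ suc β)) (pad (a ℤ.^ x) (a ℤ.^ (p ^ suc β)))
      where
      pad : ∀ u v → u ℤ.* v ≡ u ℤ.+ (v ℤ.- 1ℤ) ℤ.* u ℤ.+ 0ℤ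
      pad = solve-∀ᶻ
    split x false = sym (trans (ℤ.+-identityʳ _) (trans (ℤ.+-identityˡ _) (ℤ.*-zeroʳ b)))

theorem1p1 : (p : ℕ) → Prime p → (n : ℕ) → n ℕ.> 0 → (r : ℤ) → (α : ℕ) → α ℕ.> 0 → (l : ℕ) →
    ((e : ℕ) → IsOrd p (floorDiv n (p ^ (α ∸ 1)) !) e →
    OrdGe p (residueSum n r (p ^ α) (λ q k → binomℤ q l))
    (+ e ℤ.- + ceilDiv (p ^ (α ∸ 1) + l * p ^ α) (p ^ (α ∸ 1) * (p ∸ 1))))
    × ((a : ℤ) → (+ p) ℤD.∣ (a ℤ.- + 1) → n ℕ.≥ p ^ α →
    (e : ℕ) → IsOrd p (floorDiv n (p ^ (α ∸ 1)) !) e →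
    (+ (p ^ (e ∸ 1))) ℤD.∣ residueSum n r (p ^ α) (λ q k → a ℤ.^ k))
theorem1p1 p p-prime n n>0 r (suc β) _ l = part₁ , part₂
  where
  toUnsigned : ∀ i g → + (p ^ i) ℤS.∣ ascentSum n (onResidue (p ^ suc β) r g) →
               + (p ^ i) ℤD.∣ residueSum n r (p ^ suc β) g
  toUnsigned i g d =
    ℤS.∣⇒∣ᵤ {+ (p ^ i)} (subst (+ (p ^ i) ℤS.∣_) (sym (residueSum≡ascentSum n n>0 r (p ^ suc β) g)) d)

  ord∣ : ∀ e → IsOrd p (floorDiv n (p ^ β) !) e → p ^ e ∣ ⌊_/p^_⌋ p-prime n β !
  ord∣ e (d , _) = subst (λ m → p ^ e ∣ m !) (floorDiv≡⌊/p^⌋ p-prime β r n) d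

  part₁ : (e : ℕ) → IsOrd p (floorDiv n (p ^ β) !) e →
          OrdGe p (residueSum n r (p ^ suc β) (λ q k → binomℤ q l))
                  (+ e ℤ.- + ceilDiv (p ^ β + l * p ^ suc β) (p ^ β * (p ∸ 1)))
  part₁ e ord i i≤ = toUnsigned i (λ q k → binomℤ q l)
    (ascentSum-∣ p-prime β n e c (binomial-decay p-prime β r l) (ord∣ e ord)
      (≤-ceilDiv-* _ (φ p-prime β) (φ≢0 p-prime β)) i
      -- The bound i ≤ e - c holds in the integers, where e - c may be negative; adding `c` returns
      -- it to natural numbers.
      (ℤ.drop‿+≤+ (subst (+ (i + c) ℤ.≤_) (cancel (+ e) (+ c)) (ℤ.+-monoˡ-≤ (+ c) i≤))))
    where
    c = ceilDiv (p ^ β + l * p ^ suc β) (p ^ β * (p ∸ 1))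
    cancel : ∀ e c → e ℤ.- c ℤ.+ c ≡ e
    cancel = solve-∀ᶻ

  part₂ : (a : ℤ) → (+ p) ℤD.∣ (a ℤ.- + 1) → n ℕ.≥ p ^ suc β →
          (e : ℕ) → IsOrd p (floorDiv n (p ^ β) !) e →
          (+ (p ^ (e ∸ 1))) ℤD.∣ residueSum n r (p ^ suc β) (λ q k → a ℤ.^ k)
  -- Truncated subtraction makes the exponent 0 here.
  part₂ a d _ zero    ord = 1∣ _
  part₂ a d _ (suc e) ord = toUnsigned e (λ q k → a ℤ.^ k)
    (ascentSum-∣ p-prime β n (suc e) 1 (power-decay p-prime β r a (ℤS.∣ᵤ⇒∣ d)) (ord∣ (suc e) ord)
      -- The constant p^β is at most φ, so only one factor p is lost: c = 1.
      (≤-trans (p^β≤φ p-prime β) (≤-reflexive (sym (*-identityˡ _)))) e (≤-reflexive (+-comm e 1)))
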